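{- For every constant $\varepsilon$ with $0<\varepsilon<1$, there is no deterministic online exploration algorithm that is $(2-\varepsilon)$-competitive on tadpole graphs with unit edge weights; that is, for every such algorithm $A$ there exist a unit-weight tadpole graph $G$ and a starting vertex $s$ such that $\mathrm{cost}_A(G,s) > (2-\varepsilon)\cdot \mathrm{cost}_{\mathrm{opt}}(G,s)$, even when the searcher is promised that the input graph is a tadpole graph.
   Context: A tadpole graph $T_{i,j}$ ($i\ge 3$, $j\ge 1$) is a connected undirected graph consisting of a cycle on $i$ vertices together with a path (the stem) of $j$ further vertices, one endpoint of which is joined by an edge to one vertex of the cycle (the junction); equivalently, exactly one vertex has degree 1, exactly one has degree 3, and all others have degree 2. Every edge $e$ carries a positive weight $c(e)$; here all weights equal 1. Online exploration model: vertices have unique identifiers; a searcher starts at a vertex $s$, initially knowing only $s$; whenever it arrives at a vertex $v$ it learns the identifiers of all neighbours of $v$ and the weights of all edges incident to $v$. Moving along an edge costs its weight (each time it is traversed). The searcher (with unlimited computation and memory) must perform a closed walk from $s$ visiting all vertices and returning to $s$. $\mathrm{cost}_A(G,s)$ is the total cost of the walk produced by algorithm $A$, and $\mathrm{cost}_{\mathrm{opt}}(G,s)$ is the minimum cost of a closed walk from $s$ visiting all vertices of $G$. An algorithm is $c$-competitive on a graph class if $\mathrm{cost}_A(G,s)\le c\cdot\mathrm{cost}_{\mathrm{opt}}(G,s)$ for all graphs $G$ in the class and all start vertices $s$. -}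

module Defs where

open import Data.Nat using (ℕ; zero; suc; _+_; _*_; _∸_; _≤_; _<_; _≤ᵇ_; _≡ᵇ_; _<ᵇ_)
open import Data.Bool using (Bool; true; false; _∧_; _∨_; if_then_else_)
open import Data.Fin using (Fin; toℕ; inject₁)
open import Data.Fin.Base as F using ()
open import Data.List using (List; []; _∷_; map; filter; reverse; length)
open import Data.List.Membership.Propositional using (_∈_)
open import Data.Vec using (Vec; lookup; allFin; toList)
import Data.Vec.Membership.Propositional as VM
open import Data.Maybe using (Maybe; just; nothing)
open import Data.Product using (Σ; _×_; _,_)
open import Relation.Binary.PropositionalEquality using (_≡_)
open import Relation.Nullary.Decidable using (⌊_⌋)
open import Data.Nat.Properties using (_≟_)

-- Unit-weight tadpole graphs T_{i,j} with vertex identifiers.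
-- Vertices are indexed by Fin (i + j): indices 0 .. i-1 form the cycle
-- (in cyclic order, index 0 is the junction), indices i .. i+j-1 form
-- the stem (index i is joined to the junction, index i+j-1 is the leaf).
-- `ids` assigns pairwise distinct identifiers (natural numbers).

record Tadpole : Set where
  field
    i    : ℕ
    j    : ℕ
    i≥3  : 3 ≤ i
    j≥1  : 1 ≤ j
    ids  : Vec ℕ (i + j)
    ids-injective : ∀ x y → lookup ids x ≡ lookup ids y → x ≡ y

open Tadpole public

size : Tadpole → ℕ
size T = i T + j T

Vertex : Tadpole → Set
Vertex T = Fin (size T)

edge→ : ℕ → ℕ → ℕ → Bool
edge→ i a b =
     ((a <ᵇ i) ∧ (b <ᵇ i) ∧ (b ≡ᵇ suc a))
  ∨ ((a ≡ᵇ i ∸ 1) ∧ (b ≡ᵇ 0))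
  ∨ ((a ≡ᵇ 0) ∧ (b ≡ᵇ i))
  ∨ ((i ≤ᵇ a) ∧ (b ≡ᵇ suc a))

Adj : (T : Tadpole) → Vertex T → Vertex T → Bool
Adj T x y = edge→ (i T) (toℕ x) (toℕ y) ∨ edge→ (i T) (toℕ y) (toℕ x)

idOf : (T : Tadpole) → Vertex T → ℕ
idOf T x = lookup (ids T) x

-- insertion sort on ℕ (canonical, order-free presentation of a set of ids)
insertℕ : ℕ → List ℕ → List ℕ
insertℕ n [] = n ∷ []
insertℕ n (m ∷ ms) = if n ≤ᵇ m then n ∷ m ∷ ms else m ∷ insertℕ n ms

sortℕ : List ℕ → List ℕ
sortℕ [] = []
sortℕ (n ∷ ns) = insertℕ n (sortℕ ns)

-- Online exploration.
-- Upon arriving at vertex v the searcher observes the identifier of v and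
-- the (sorted) list of identifiers of its neighbours.  All edge weights are
-- 1, so the weight information is constant and is omitted.

Obs : Set
Obs = ℕ × List ℕ

observe : (T : Tadpole) → Vertex T → Obs
observe T x = idOf T x , sortℕ (map (idOf T) (filter (λ y → Adj T x y ≡? true) (toList (allFin (size T)))))
  where
  open import Data.Bool.Properties using () renaming (_≟_ to _≡?_)

-- A deterministic online algorithm: given the chronological list of all
-- observations so far (the first being that of the start vertex, the last
-- that of the current vertex) it either names the identifier of the next
-- vertex to move to (`just id`), or stops (`nothing`).
Algorithm : Set
Algorithm = List Obs → Maybe ℕ

history : (T : Tadpole) → List (Vertex T) → List Obs
history T xs = reverse (map (observe T) xs)

-- `Reach A T s xs`: xs (most recent first) is the sequence of positions
-- of the searcher in the run of A on (T, s); every move goes along an edge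
-- to the neighbour whose identifier A named.
data Reach (A : Algorithm) (T : Tadpole) (s : Vertex T) : List (Vertex T) → Set where
  start : Reach A T s (s ∷ [])
  move  : ∀ {x xs} (y : Vertex T) →
          Reach A T s (x ∷ xs) →
          A (history T (x ∷ xs)) ≡ just (idOf T y) →
          Adj T x y ≡ true →
          Reach A T s (y ∷ x ∷ xs)

Explores : Algorithm → (T : Tadpole) → Vertex T → ℕ → Set
Explores A T s k =
  Σ (List (Vertex T)) λ xs →
    Reach A T s (s ∷ xs) ×
    length xs ≡ k ×
    A (history T (s ∷ xs)) ≡ nothing ×
    (∀ v → v ∈ (s ∷ xs))

CoverWalk : (T : Tadpole) → Vertex T → ℕ → Set
CoverWalk T s m =
  Σ (Vec (Vertex T) (suc m)) λ w →
    lookup w F.zero ≡ s ×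
    lookup w (F.fromℕ m) ≡ s ×
    (∀ (k : Fin m) → Adj T (lookup w (inject₁ k)) (lookup w (F.suc k)) ≡ true) ×
    (∀ v → v VM.∈ w)

IsOptCost : (T : Tadpole) → Vertex T → ℕ → Set
IsOptCost T s m = CoverWalk T s m × (∀ m' → CoverWalk T s m' → m ≤ m')

{-# OPTIONS --safe #-}

-- The searcher starts at depth d from a junction that has two further branches, while the
-- other direction from the start is a third unexplored ray.  Which of the two directions
-- leads to the junction is decided adversarially: it is the one first followed to depth d.
-- The branches are explored to depths x and y and the ray to depth z; as soon as
-- x + z = d (or symmetrically y + z = d) the ends of the first branch and of the ray are
-- joined, which closes a cycle of length about 2d with the start antipodal to the junction,
-- and the second branch is ended just beyond the explored part.  Visiting a subtree with n
-- edges and ending at depth h costs at least 2n - h, and from the point of closure the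
-- searcher still has to walk to the leaf and from there back to the start; this adds up to
-- at least 4d + 4y up to a constant, whereas the optimum is about 2d + 2y.

module Submission where

open import Defs
open import Data.Bool using (Bool; true; false; T; _∧_; _∨_)
open import Data.Bool.Properties using (T-≡) renaming (_≟_ to _≟ᵇ_)
open import Data.Empty using (⊥; ⊥-elim)
open import Data.Fin using (Fin; toℕ; fromℕ; fromℕ<; inject₁)
open import Data.Fin.Properties using (toℕ-injective; toℕ-fromℕ<; toℕ<n)
open import Data.List using (List; []; _∷_; _++_; map; filter; reverse; length; tabulate; _∷ʳ′_; initLast; _∷ʳ_)
open import Data.List.Membership.Propositional using (_∈_; find; lose)
open import Data.List.Membership.Propositional.Properties using (∈-filter⁺; ∈-filter⁻; ∈-map⁻; ∈-map⁺; ∈-++⁻)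
open import Data.List.Membership.Propositional.Properties.WithK using (unique∧set⇒bag)
open import Data.List.Properties using (∷ʳ-++; length-map; length-++; ∷-injectiveˡ)
open import Data.List.Relation.Binary.BagAndSetEquality using (∼bag⇒↭)
open import Data.List.Relation.Binary.Permutation.Propositional using (_↭_; prep; swap; ↭-refl)
import Data.List.Relation.Binary.Permutation.Propositional as Perm
import Data.List.Relation.Binary.Permutation.Propositional.Properties as Permₚ
open import Data.List.Relation.Unary.All using (All; []; _∷_)
import Data.List.Relation.Unary.All as All
import Data.List.Relation.Unary.All.Properties as Allₚ
open import Data.List.Relation.Unary.AllPairs using ([]; _∷_)
open import Data.List.Relation.Unary.Any using (here; there; any?)
open import Data.List.Relation.Unary.Unique.Propositional using (Unique)
import Data.List.Relation.Unary.Unique.Propositional.Properties as Uniqueₚ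
open import Data.Maybe using (just; nothing)
open import Data.Maybe.Properties using (just-injective; ≡-dec)
open import Data.Nat
open import Data.Nat.Properties
open import Data.Nat.Tactic.RingSolver using (solve-∀)
import Data.Product as Product
open import Data.Product using (Σ; ∃; _×_; _,_; proj₁; proj₂)
import Data.Sum as Sum
open import Data.Sum using (_⊎_; inj₁; inj₂; [_,_]′)
open import Data.Unit using (tt; ⊤)
open import Data.Vec using (Vec; lookup)
import Data.Vec as Vec
open import Data.Vec.Membership.Propositional using () renaming (_∈_ to _∈ᵛ_)
import Data.Vec.Membership.Propositional.Properties as VecMemₚ
open import Data.Vec.Properties using (lookup∘tabulate)
open import Data.Vec.Relation.Unary.Any using () renaming (here to hereᵛ; there to thereᵛ)
open import Function using (_∘_; id; case_of_)
open import Function.Bundles using (mk⇔; Equivalence)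
open import Relation.Binary.PropositionalEquality using (_≡_; _≢_; refl; sym; trans; cong; cong₂; subst; subst₂; module ≡-Reasoning)
open import Relation.Nullary using (¬_; yes; no; contradiction)

-- Insertion sort does not depend on the order of its input.

insertℕ-≤ : ∀ {a b} bs → a ≤ b → insertℕ a (b ∷ bs) ≡ a ∷ b ∷ bs
insertℕ-≤ {a} {b} bs a≤b with a ≤ᵇ b in eq
... | true  = refl
... | false = ⊥-elim (subst T eq (≤⇒≤ᵇ a≤b))

insertℕ-> : ∀ {a b} bs → b < a → insertℕ a (b ∷ bs) ≡ b ∷ insertℕ a bs
insertℕ-> {a} {b} bs b<a with a ≤ᵇ b in eq
... | true  = contradiction (≤ᵇ⇒≤ a b (subst T (sym eq) tt)) (<⇒≱ b<a)
... | false = refl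

insertℕ-comm-≤ : ∀ {a b} cs → a ≤ b → insertℕ a (insertℕ b cs) ≡ insertℕ b (insertℕ a cs)
insertℕ-comm-≤ {a} {b} [] a≤b with m≤n⇒m<n∨m≡n a≤b
... | inj₂ refl = refl
... | inj₁ a<b = trans (insertℕ-≤ [] a≤b) (sym (insertℕ-> [] a<b))
insertℕ-comm-≤ {a} {b} (c ∷ cs) a≤b with m≤n⇒m<n∨m≡n a≤b | ≤-<-connex a c | ≤-<-connex b c
... | inj₂ refl | _ | _ = refl
... | inj₁ a<b | inj₁ a≤c | inj₁ b≤c = begin
  insertℕ a (insertℕ b (c ∷ cs)) ≡⟨ cong (insertℕ a) (insertℕ-≤ cs b≤c) ⟩
  insertℕ a (b ∷ c ∷ cs)         ≡⟨ insertℕ-≤ (c ∷ cs) a≤b ⟩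
  a ∷ b ∷ c ∷ cs                 ≡⟨ cong (a ∷_) (insertℕ-≤ cs b≤c) ⟨
  a ∷ insertℕ b (c ∷ cs)         ≡⟨ insertℕ-> (c ∷ cs) a<b ⟨
  insertℕ b (a ∷ c ∷ cs)         ≡⟨ cong (insertℕ b) (insertℕ-≤ cs a≤c) ⟨
  insertℕ b (insertℕ a (c ∷ cs)) ∎
  where open ≡-Reasoning
... | inj₁ a<b | inj₁ a≤c | inj₂ c<b = begin
  insertℕ a (insertℕ b (c ∷ cs)) ≡⟨ cong (insertℕ a) (insertℕ-> cs c<b) ⟩
  insertℕ a (c ∷ insertℕ b cs)   ≡⟨ insertℕ-≤ (insertℕ b cs) a≤c ⟩
  a ∷ c ∷ insertℕ b cs           ≡⟨ cong (a ∷_) (insertℕ-> cs c<b) ⟨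
  a ∷ insertℕ b (c ∷ cs)         ≡⟨ insertℕ-> (c ∷ cs) a<b ⟨
  insertℕ b (a ∷ c ∷ cs)         ≡⟨ cong (insertℕ b) (insertℕ-≤ cs a≤c) ⟨
  insertℕ b (insertℕ a (c ∷ cs)) ∎
  where open ≡-Reasoning
... | inj₁ a<b | inj₂ c<a | inj₁ b≤c = contradiction (<-≤-trans a<b b≤c) (<⇒≯ c<a)
... | inj₁ a<b | inj₂ c<a | inj₂ c<b = begin
  insertℕ a (insertℕ b (c ∷ cs)) ≡⟨ cong (insertℕ a) (insertℕ-> cs c<b) ⟩
  insertℕ a (c ∷ insertℕ b cs)   ≡⟨ insertℕ-> (insertℕ b cs) c<a ⟩
  c ∷ insertℕ a (insertℕ b cs)   ≡⟨ cong (c ∷_) (insertℕ-comm-≤ cs a≤b) ⟩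
  c ∷ insertℕ b (insertℕ a cs)   ≡⟨ insertℕ-> (insertℕ a cs) c<b ⟨
  insertℕ b (c ∷ insertℕ a cs)   ≡⟨ cong (insertℕ b) (insertℕ-> cs c<a) ⟨
  insertℕ b (insertℕ a (c ∷ cs)) ∎
  where open ≡-Reasoning

insertℕ-comm : ∀ a b cs → insertℕ a (insertℕ b cs) ≡ insertℕ b (insertℕ a cs)
insertℕ-comm a b cs with ≤-total a b
... | inj₁ a≤b = insertℕ-comm-≤ cs a≤b
... | inj₂ b≤a = sym (insertℕ-comm-≤ cs b≤a)

-- This is why an observation depends only on which neighbours a vertex has, and not on the order in
-- which a graph lists them.
sortℕ-resp-↭ : ∀ {xs ys} → xs ↭ ys → sortℕ xs ≡ sortℕ ys
sortℕ-resp-↭ Perm.refl = refl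
sortℕ-resp-↭ (prep x p) = cong (insertℕ x) (sortℕ-resp-↭ p)
sortℕ-resp-↭ {ys = _ ∷ _ ∷ ys} (swap x y p) =
  trans (cong (insertℕ x ∘ insertℕ y) (sortℕ-resp-↭ p)) (insertℕ-comm x y (sortℕ ys))
sortℕ-resp-↭ (Perm.trans p q) = trans (sortℕ-resp-↭ p) (sortℕ-resp-↭ q)

-- Networks, runs, and lifting runs along local isomorphisms.

-- Covers both the finite tadpoles and the infinite tree on which the adversary plays, so that runs
-- on the two can be compared.
record Network : Set₁ where
  field
    Node : Set
    label : Node → ℕ
    nbrs : Node → List Node

  obs : Node → Obs
  obs v = label v , sortℕ (map label (nbrs v))

  obsHistory : List Node → List Obs
  obsHistory xs = reverse (map obs xs)


open Network

data Run (A : Algorithm) (G : Network) (s : Node G) : List (Node G) → Set where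
  start : Run A G s (s ∷ [])
  move  : ∀ {x xs} y → Run A G s (x ∷ xs) → A (obsHistory G (x ∷ xs)) ≡ just (label G y) →
          y ∈ nbrs G x → Run A G s (y ∷ x ∷ xs)

module Lift {A : Algorithm} {G H : Network} (g : Node H → Node G)
            (label-g : ∀ x → label G (g x) ≡ label H x)
            (P : Node G → Set)
            (local : ∀ x → P (g x) → map g (nbrs H x) ↭ nbrs G (g x)) where

  obs-g : ∀ x → P (g x) → obs H x ≡ obs G (g x)
  obs-g x px = cong₂ _,_ (sym (label-g x)) (trans (cong sortℕ (eq (nbrs H x)))
                 (sortℕ-resp-↭ (Permₚ.map⁺ (label G) (local x px))))
    where
    eq : ∀ ys → map (label H) ys ≡ map (label G) (map g ys)
    eq [] = refl
    eq (y ∷ ys) = cong₂ _∷_ (sym (label-g y)) (eq ys)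

  map-obs-g : ∀ xs → All P (map g xs) → map (obs H) xs ≡ map (obs G) (map g xs)
  map-obs-g [] [] = refl
  map-obs-g (x ∷ xs) (px ∷ pxs) = cong₂ _∷_ (obs-g x px) (map-obs-g xs pxs)

  history-g : ∀ xs → All P (map g xs) → obsHistory H xs ≡ obsHistory G (map g xs)
  history-g xs pxs = cong reverse (map-obs-g xs pxs)

  -- Where `g` preserves labels and maps neighbourhoods bijectively, the algorithm receives equal
  -- observations and answers alike. `P` is asked of `ys` only: the observation made at the newest
  -- node `y` has not yet influenced any move.
  lift : ∀ {s y ys} → All P ys → Run A G (g s) (y ∷ ys) →
         ∃ λ x → ∃ λ xs → g x ≡ y × map g xs ≡ ys × Run A H s (x ∷ xs)
  lift _ start = _ , [] , refl , refl , start
  lift ps@(px ∷ pxs) (move y r a y∈) with lift pxs r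
  ... | x , xs , refl , refl , r′ with ∈-map⁻ g (Permₚ.∈-resp-↭ (Perm.↭-sym (local x px)) y∈)
  ...   | y′ , y′∈ , refl = y′ , x ∷ xs , refl , refl ,
            move y′ r′ (trans (cong A (history-g (x ∷ xs) ps)) (trans a (cong just (label-g y′)))) y′∈

-- Tadpoles as networks.

network : Tadpole → Network
network T .Node = Vertex T
network T .label = idOf T
network T .nbrs x = filter (λ y → Adj T x y ≟ᵇ true) (Vec.toList (Vec.allFin (size T)))

toList-tabulate : ∀ {X : Set} n (f : Fin n → X) → Vec.toList (Vec.tabulate f) ≡ tabulate f
toList-tabulate zero f = refl
toList-tabulate (suc n) f = cong (f Fin.zero ∷_) (toList-tabulate n (f ∘ Fin.suc))

module _ (T : Tadpole) where

  nbrs-unique : ∀ x → Unique (nbrs (network T) x)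
  nbrs-unique x = Uniqueₚ.filter⁺ (λ y → Adj T x y ≟ᵇ true)
    (subst Unique (sym (toList-tabulate (size T) id)) (Uniqueₚ.allFin⁺ (size T)))

  Adj⇒∈nbrs : ∀ {x y} → Adj T x y ≡ true → y ∈ nbrs (network T) x
  Adj⇒∈nbrs {x} {y} = ∈-filter⁺ (λ y → Adj T x y ≟ᵇ true) (VecMemₚ.∈-toList⁺ (VecMemₚ.∈-allFin⁺ y))

  ∈nbrs⇒Adj : ∀ {x y} → y ∈ nbrs (network T) x → Adj T x y ≡ true
  ∈nbrs⇒Adj {x} = proj₂ ∘ ∈-filter⁻ (λ y → Adj T x y ≟ᵇ true) {xs = Vec.toList (Vec.allFin (size T))}

  Run⇒Reach : ∀ {A s xs} → Run A (network T) s xs → Reach A T s xs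
  Run⇒Reach start = start
  Run⇒Reach (move y r a y∈) = move y (Run⇒Reach r) a (∈nbrs⇒Adj y∈)

  id-injective : ∀ {x y} → idOf T x ≡ idOf T y → x ≡ y
  id-injective = ids-injective T _ _

-- Determinism of runs, and lower bounds on their length by potentials.

module _ {A : Algorithm} {T : Tadpole} {s : Vertex T} where

  Reach-ends : ∀ {xs} → Reach A T s xs → ∃ λ us → xs ≡ us ++ s ∷ []
  Reach-ends start = [] , refl
  Reach-ends (move y r _ _) with Reach-ends r
  ... | us , eq = y ∷ us , cong (y ∷_) eq

  Reach-next : ∀ us {y x xs} → Reach A T s (us ++ y ∷ x ∷ xs) →
               A (history T (x ∷ xs)) ≡ just (idOf T y) × Adj T x y ≡ true
  Reach-next [] (move _ _ a e) = a , e
  Reach-next (u ∷ []) (move _ r _ _) = Reach-next [] r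
  Reach-next (u ∷ us@(_ ∷ _)) (move _ r _ _) = Reach-next us r

module _ {A : Algorithm} {T : Tadpole} {s : Vertex T} where

  -- The algorithm is deterministic and identifiers are distinct, so one of two runs from the same
  -- start is a prefix of the other; a run that has stopped cannot be the proper prefix.
  stopped-extends : ∀ {xs ys} → Reach A T s xs → A (history T xs) ≡ nothing →
                    Reach A T s ys → ∃ λ us → xs ≡ us ++ ys
  stopped-extends r _ start = Reach-ends r
  stopped-extends r stop (move {x} {xs} y r′ a _) with stopped-extends r stop r′
  ... | us , refl with initLast us
  ...   | [] = case trans (sym stop) a of λ ()
  ...   | us′ ∷ʳ′ z = us′ , trans eq (cong (λ v → us′ ++ v ∷ x ∷ xs) z≡y)
    where
    eq : (us′ ∷ʳ z) ++ x ∷ xs ≡ us′ ++ z ∷ x ∷ xs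
    eq = ∷ʳ-++ us′ z (x ∷ xs)
    z≡y : z ≡ y
    z≡y = id-injective T (just-injective
            (trans (sym (proj₁ (Reach-next us′ (subst (Reach A T s) eq r)))) a))

  module _ (φ : Vertex T → ℕ)
           (lipschitz : ∀ {x y} → Adj T x y ≡ true → φ x ≤ suc (φ y) × φ y ≤ suc (φ x)) where

    distance-bound : ∀ {p q ps} us → Reach A T s (q ∷ us ++ p ∷ ps) → φ p ≤ suc (length us) + φ q
    distance-bound [] (move _ _ _ e) = proj₁ (lipschitz e)
    distance-bound {p} {q} (u ∷ us) (move _ r _ e) = begin
      φ p                         ≤⟨ distance-bound us r ⟩
      suc (length us) + φ u       ≤⟨ +-monoʳ-≤ (suc (length us)) (proj₁ (lipschitz e)) ⟩
      suc (length us) + suc (φ q) ≡⟨ +-suc (suc (length us)) (φ q) ⟩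
      suc (suc (length us)) + φ q ∎
      where open ≤-Reasoning

    -- A 1-Lipschitz potential vanishing at `v` bounds distances to `v` from below: `φ p` moves are
    -- spent before a visit to `v` and `φ q` after it.
    detour-bound : ∀ {p q ps v} us → φ v ≡ 0 → v ∈ q ∷ us → Reach A T s (q ∷ us ++ p ∷ ps) →
                   φ p + φ q ≤ suc (length us)
    detour-bound {p} {q} us φv≡0 (here refl) r = begin
      φ p + φ q                     ≤⟨ +-monoˡ-≤ (φ q) (distance-bound us r) ⟩
      suc (length us) + φ q + φ q   ≡⟨ cong (λ n → suc (length us) + n + n) φv≡0 ⟩
      suc (length us) + 0 + 0       ≡⟨ trans (+-identityʳ _) (+-identityʳ _) ⟩
      suc (length us)               ∎
      where open ≤-Reasoning
    detour-bound {p} {q} (u ∷ us) φv≡0 (there v∈) (move _ r _ e) = begin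
      φ p + φ q           ≤⟨ +-monoʳ-≤ (φ p) (proj₂ (lipschitz e)) ⟩
      φ p + suc (φ u)     ≡⟨ +-suc (φ p) (φ u) ⟩
      suc (φ p + φ u)     ≤⟨ s≤s (detour-bound us φv≡0 v∈ r) ⟩
      suc (suc (length us)) ∎
      where open ≤-Reasoning

-- The Boolean edge test as an inductive relation.

data Edge (i : ℕ) : ℕ → ℕ → Set where
  cycle-edge   : ∀ {a} → suc a < i → Edge i a (suc a)
  closing-edge : ∀ {a} → suc a ≡ i → Edge i a 0
  first-stem   : Edge i 0 i
  stem-edge    : ∀ {a} → i ≤ a → Edge i a (suc a)

private
  ∨-true : ∀ a {b} → a ∨ b ≡ true → a ≡ true ⊎ b ≡ true
  ∨-true true  _ = inj₁ refl
  ∨-true false e = inj₂ e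

  ∧-true : ∀ a {b} → a ∧ b ≡ true → a ≡ true × b ≡ true
  ∧-true true e = refl , e

  true⇒T : ∀ {b} → b ≡ true → T b
  true⇒T = Equivalence.from T-≡

  T⇒true : ∀ {b} → T b → b ≡ true
  T⇒true = Equivalence.to T-≡

  ∨-introʳ : ∀ a {b} → b ≡ true → a ∨ b ≡ true
  ∨-introʳ true  _ = refl
  ∨-introʳ false e = e

  ∨-introˡ : ∀ {a} b → a ≡ true → a ∨ b ≡ true
  ∨-introˡ b refl = refl

edge→⇒Edge : ∀ i {a b} → 0 < i → edge→ i a b ≡ true → Edge i a b
edge→⇒Edge i@(suc i′) {a} {b} _ e with ∨-true ((a <ᵇ i) ∧ (b <ᵇ i) ∧ (b ≡ᵇ suc a)) e
... | inj₁ e₁ with ∧-true (a <ᵇ i) e₁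
...   | _ , e₂ with ∧-true (b <ᵇ i) e₂
...     | b<i , b≡ with refl ← ≡ᵇ⇒≡ b (suc a) (true⇒T b≡) = cycle-edge (<ᵇ⇒< b i (true⇒T b<i))
edge→⇒Edge i@(suc i′) {a} {b} _ e | inj₂ e₁ with ∨-true ((a ≡ᵇ i′) ∧ (b ≡ᵇ 0)) e₁
... | inj₁ e₂ with ∧-true (a ≡ᵇ i′) e₂
...   | a≡ , b≡ with refl ← ≡ᵇ⇒≡ a i′ (true⇒T a≡) | refl ← ≡ᵇ⇒≡ b 0 (true⇒T b≡) = closing-edge refl
edge→⇒Edge i@(suc i′) {a} {b} _ e | inj₂ e₁ | inj₂ e₂ with ∨-true ((a ≡ᵇ 0) ∧ (b ≡ᵇ i)) e₂
... | inj₁ e₃ with ∧-true (a ≡ᵇ 0) e₃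
...   | a≡ , b≡ with refl ← ≡ᵇ⇒≡ a 0 (true⇒T a≡) | refl ← ≡ᵇ⇒≡ b i (true⇒T b≡) = first-stem
edge→⇒Edge i@(suc i′) {a} {b} _ e | inj₂ e₁ | inj₂ e₂ | inj₂ e₃ with ∧-true (i ≤ᵇ a) e₃
... | i≤a , b≡ with refl ← ≡ᵇ⇒≡ b (suc a) (true⇒T b≡) = stem-edge (≤ᵇ⇒≤ i a (true⇒T i≤a))

Edge⇒edge→ : ∀ {i a b} → Edge i a b → edge→ i a b ≡ true
Edge⇒edge→ {i} {a} (cycle-edge a<i) = ∨-introˡ _ (cong₂ _∧_ (T⇒true (<⇒<ᵇ (<-trans (n<1+n a) a<i)))
  (cong₂ _∧_ (T⇒true (<⇒<ᵇ a<i)) (T⇒true (≡⇒≡ᵇ a a refl))))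
Edge⇒edge→ {i} {a} (closing-edge refl) = ∨-introʳ ((a <ᵇ i) ∧ (0 <ᵇ i) ∧ (0 ≡ᵇ suc a))
  (∨-introˡ _ (cong₂ _∧_ (T⇒true (≡⇒≡ᵇ a a refl)) refl))
Edge⇒edge→ {i} first-stem = ∨-introʳ ((0 <ᵇ i) ∧ (i <ᵇ i) ∧ (i ≡ᵇ 1))
  (∨-introʳ ((0 ≡ᵇ i ∸ 1) ∧ (i ≡ᵇ 0)) (∨-introˡ _ (T⇒true (≡⇒≡ᵇ i i refl))))
Edge⇒edge→ {i} {a} (stem-edge i≤a) = ∨-introʳ ((a <ᵇ i) ∧ (suc a <ᵇ i) ∧ (a ≡ᵇ a))
  (∨-introʳ ((a ≡ᵇ i ∸ 1) ∧ false)
    (∨-introʳ ((a ≡ᵇ 0) ∧ (suc a ≡ᵇ i)) (cong₂ _∧_ (T⇒true (≤⇒≤ᵇ i≤a)) (T⇒true (≡⇒≡ᵇ a a refl)))))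

module _ (T : Tadpole) where

  0<i : 0 < i T
  0<i = ≤-trans (s≤s z≤n) (i≥3 T)

  Adj⇒Edge : ∀ {x y} → Adj T x y ≡ true → Edge (i T) (toℕ x) (toℕ y) ⊎ Edge (i T) (toℕ y) (toℕ x)
  Adj⇒Edge {x} {y} e = Sum.map (edge→⇒Edge (i T) 0<i) (edge→⇒Edge (i T) 0<i)
                         (∨-true (edge→ (i T) (toℕ x) (toℕ y)) e)

  Edge⇒Adj : ∀ {x y} → Edge (i T) (toℕ x) (toℕ y) ⊎ Edge (i T) (toℕ y) (toℕ x) → Adj T x y ≡ true
  Edge⇒Adj {x} {y} (inj₁ e) = ∨-introˡ _ (Edge⇒edge→ e)
  Edge⇒Adj {x} {y} (inj₂ e) = ∨-introʳ (edge→ (i T) (toℕ x) (toℕ y)) (Edge⇒edge→ e)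

-- A potential for the leaf.

-- The distance to the leaf: around the cycle to the junction, then down the stem.
leafDistance : ℕ → ℕ → ℕ → ℕ
leafDistance i j n = n ⊓ (i ∸ n) + (j ∸ (suc n ∸ i))

private
  ∸-suc-≤ : ∀ m n → m ∸ suc n ≤ m ∸ n
  ∸-suc-≤ m n = ∸-monoʳ-≤ m (n≤1+n n)

  ∸-≤-suc : ∀ m n → m ∸ n ≤ suc (m ∸ suc n)
  ∸-≤-suc zero n = ≤-trans (≤-reflexive (0∸n≡0 n)) z≤n
  ∸-≤-suc (suc m) zero = ≤-refl
  ∸-≤-suc (suc m) (suc n) = ∸-≤-suc m n

-- On the cycle the truncated `suc n ∸ i` vanishes, on the stem `i ∸ n` does; each of the four kinds
-- of edge then changes a single summand by at most one.
leafDistance-lipschitz : ∀ {i j a b} → 0 < i → Edge i a b →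
  leafDistance i j a ≤ suc (leafDistance i j b) × leafDistance i j b ≤ suc (leafDistance i j a)
leafDistance-lipschitz {i} {j} {a} 0<i (cycle-edge a<i)
  rewrite m≤n⇒m∸n≡0 a<i | m≤n⇒m∸n≡0 (<⇒≤ a<i) =
    +-monoˡ-≤ j (⊓-mono-≤ (m≤n⇒m≤1+n (n≤1+n a)) (∸-≤-suc i a)) ,
    +-monoˡ-≤ j (⊓-mono-≤ (≤-refl {suc a}) (m≤n⇒m≤1+n (∸-suc-≤ i a)))
leafDistance-lipschitz {i} {j} {a} 0<i (closing-edge refl)
  rewrite n∸n≡0 a | m+n∸n≡m 1 a | 0∸n≡0 a =
    +-monoˡ-≤ j (m⊓n≤n a 1) , m≤n⇒m≤1+n (m≤n+m j (a ⊓ 1))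
leafDistance-lipschitz {i} {j} 0<i first-stem
  rewrite m≤n⇒m∸n≡0 0<i | n∸n≡0 i | ⊓-zeroʳ i | m+n∸n≡m 1 i =
    ∸-≤-suc j 0 , m≤n⇒m≤1+n (m∸n≤m j 1)
leafDistance-lipschitz {i} {j} {a} 0<i (stem-edge i≤a)
  rewrite m≤n⇒m∸n≡0 i≤a | m≤n⇒m∸n≡0 (m≤n⇒m≤1+n i≤a) | ⊓-zeroʳ a
        | +-∸-assoc 1 (m≤n⇒m≤1+n i≤a) = ∸-≤-suc j (suc a ∸ i) , m≤n⇒m≤1+n (∸-suc-≤ j (suc a ∸ i))

-- A covering walk that bounds the optimum from above.

data Walk (T : Tadpole) : Vertex T → Vertex T → ℕ → Set where
  []  : ∀ {x} → Walk T x x 0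
  _∷_ : ∀ {x y z n} → Adj T x y ≡ true → Walk T y z n → Walk T x z (suc n)

module _ {T : Tadpole} where

  vertices : ∀ {x y n} → Walk T x y n → Vec (Vertex T) (suc n)
  vertices {x} [] = x Vec.∷ Vec.[]
  vertices {x} (_ ∷ w) = x Vec.∷ vertices w

  lookup-first : ∀ {x y n} (w : Walk T x y n) → lookup (vertices w) Fin.zero ≡ x
  lookup-first [] = refl
  lookup-first (_ ∷ _) = refl

  lookup-last : ∀ {x y n} (w : Walk T x y n) → lookup (vertices w) (fromℕ n) ≡ y
  lookup-last [] = refl
  lookup-last (_ ∷ w) = lookup-last w

  vertices-Adj : ∀ {x y n} (w : Walk T x y n) (k : Fin n) →
    Adj T (lookup (vertices w) (inject₁ k)) (lookup (vertices w) (Fin.suc k)) ≡ true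
  vertices-Adj {x} (e ∷ w) Fin.zero = subst (λ v → Adj T x v ≡ true) (sym (lookup-first w)) e
  vertices-Adj (_ ∷ w) (Fin.suc k) = vertices-Adj w k

  infixr 5 _⁀_
  _⁀_ : ∀ {x y z m n} → Walk T x y m → Walk T y z n → Walk T x z (m + n)
  [] ⁀ w′ = w′
  (e ∷ w) ⁀ w′ = e ∷ (w ⁀ w′)

  _∋_ : ∀ {x y n} → Walk T x y n → Vertex T → Set
  w ∋ v = v ∈ᵛ vertices w

  first-∋ : ∀ {x y n} (w : Walk T x y n) → w ∋ x
  first-∋ [] = hereᵛ refl
  first-∋ (_ ∷ _) = hereᵛ refl

  ∋-⁀ʳ : ∀ {x y z m n} (w : Walk T x y m) (w′ : Walk T y z n) {v} → w′ ∋ v → (w ⁀ w′) ∋ v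
  ∋-⁀ʳ [] w′ v∈ = v∈
  ∋-⁀ʳ (_ ∷ w) w′ v∈ = thereᵛ (∋-⁀ʳ w w′ v∈)

  ∋-⁀ˡ : ∀ {x y z m n} (w : Walk T x y m) (w′ : Walk T y z n) {v} → w ∋ v → (w ⁀ w′) ∋ v
  ∋-⁀ˡ [] w′ (hereᵛ refl) = first-∋ w′
  ∋-⁀ˡ (_ ∷ w) w′ (hereᵛ refl) = hereᵛ refl
  ∋-⁀ˡ (_ ∷ w) w′ (thereᵛ v∈) = thereᵛ (∋-⁀ˡ w w′ v∈)

  along : (f : ℕ → Vertex T) → ∀ n → (∀ {k} → k < n → Adj T (f k) (f (suc k)) ≡ true) →
          Σ (Walk T (f 0) (f n) n) λ w → ∀ {k} → k ≤ n → w ∋ f k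
  along f zero _ = [] , λ { z≤n → hereᵛ refl }
  along f (suc n) e with along (f ∘ suc) n (e ∘ s≤s)
  ... | w , cover = e (s≤s z≤n) ∷ w , λ { z≤n → hereᵛ refl ; (s≤s k≤n) → thereᵛ (cover k≤n) }

Adj-sym : ∀ T {x y} → Adj T x y ≡ true → Adj T y x ≡ true
Adj-sym T e = Edge⇒Adj T (Sum.swap (Adj⇒Edge T e))

module _ (T : Tadpole) where

  -- Out of range, `vertex n` is the junction.
  vertex : ℕ → Vertex T
  vertex n with n <? size T
  ... | yes n< = fromℕ< n<
  ... | no  _  = fromℕ< (≤-trans (0<i T) (m≤m+n (i T) (j T)))

  toℕ-vertex : ∀ {n} → n < size T → toℕ (vertex n) ≡ n
  toℕ-vertex {n} n< with n <? size T
  ... | yes n<′ = toℕ-fromℕ< n<′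
  ... | no n≮ = contradiction n< n≮

  vertex-toℕ : ∀ v → vertex (toℕ v) ≡ v
  vertex-toℕ v = toℕ-injective (toℕ-vertex (toℕ<n v))

  vertex-Adj : ∀ {a b} → a < size T → b < size T → Edge (i T) a b → Adj T (vertex a) (vertex b) ≡ true
  vertex-Adj a< b< e = Edge⇒Adj T (inj₁ (subst₂ (Edge (i T)) (sym (toℕ-vertex a<)) (sym (toℕ-vertex b<)) e))

  back : (f : ℕ → Vertex T) → ∀ n → (∀ {k} → k < n → Adj T (f k) (f (suc k)) ≡ true) → Walk T (f n) (f 0) n
  back f zero _ = []
  back f (suc n) e = Adj-sym T (e ≤-refl) ∷ back f n (λ k<n → e (m≤n⇒m≤1+n k<n))

  cycle<size : ∀ {n} → n < i T → n < size T
  cycle<size n<i = ≤-trans n<i (m≤m+n (i T) (j T))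

  -- Depth 0 is the junction, so that the walk down the stem starts on the cycle.
  stemVertex : ℕ → Vertex T
  stemVertex zero    = vertex 0
  stemVertex (suc k) = vertex (i T + k)

  stem-Adj : ∀ {k} → k < j T → Adj T (stemVertex k) (stemVertex (suc k)) ≡ true
  stem-Adj {zero}  k< = vertex-Adj (cycle<size (0<i T)) (+-monoʳ-< (i T) k<)
    (subst (Edge (i T) 0) (sym (+-identityʳ (i T))) first-stem)
  stem-Adj {suc k} k< = vertex-Adj (+-monoʳ-< (i T) (<⇒≤ k<)) (+-monoʳ-< (i T) k<)
    (subst (Edge (i T) _) (sym (+-suc (i T) k)) (stem-edge (m≤m+n (i T) k)))

  -- The walk goes from index `d` forward to the last cycle vertex, over the closing edge to the
  -- junction, down the stem and up again, and then along the cycle back to `d`: every cycle edge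
  -- once and every stem edge twice.
  coverWalk : ∀ d e → suc (d + e) ≡ i T → CoverWalk T (vertex d) (i T + 2 * j T)
  coverWalk d e i≡ = subst (CoverWalk T (vertex d)) len
    (vertices w , lookup-first w , lookup-last w , vertices-Adj w , λ v → subst (w ∋_) (vertex-toℕ v) (cover (toℕ<n v)))
    where
    <i : ∀ {k} → k ≤ d + e → k < i T
    <i k≤ = subst (_ <_) i≡ (s≤s k≤)

    ahead = along (λ k → vertex (k + d)) e λ {k} k<e →
              let h = <i (subst (suc k + d ≤_) (+-comm e d) (+-monoˡ-≤ d k<e)) in
              vertex-Adj (cycle<size (<⇒≤ h)) (cycle<size h) (cycle-edge h)
    closing : Adj T (vertex (e + d)) (vertex 0) ≡ true
    closing = vertex-Adj (cycle<size (<i (≤-reflexive (+-comm e d)))) (cycle<size (0<i T))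
                (closing-edge (trans (cong suc (+-comm e d)) i≡))
    down = along stemVertex (j T) stem-Adj
    up = back stemVertex (j T) stem-Adj
    home = along vertex d λ k<d → let h = <i (≤-trans k<d (m≤m+n d e)) in
              vertex-Adj (cycle<size (<⇒≤ h)) (cycle<size h) (cycle-edge h)
    w₃ = up ⁀ proj₁ home
    w₂ = proj₁ down ⁀ w₃
    w : Walk T (vertex d) (vertex d) (e + suc (j T + (j T + d)))
    w = proj₁ ahead ⁀ (closing ∷ w₂)

    in-w₂ : ∀ {v} → w₂ ∋ v → w ∋ v
    in-w₂ = ∋-⁀ʳ (proj₁ ahead) (closing ∷ w₂) ∘ thereᵛ

    cover : ∀ {n} → n < size T → w ∋ vertex n
    cover {n} n< with n ≤? d
    ... | yes n≤d = in-w₂ (∋-⁀ʳ (proj₁ down) w₃ (∋-⁀ʳ up (proj₁ home) (proj₂ home n≤d)))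
    ... | no n≰d with n <? i T
    ...   | yes n<i = subst (λ m → w ∋ vertex m) (m∸n+n≡m (≰⇒≥ n≰d))
              (∋-⁀ˡ (proj₁ ahead) (closing ∷ w₂) (proj₂ ahead n∸d≤e))
      where
      n∸d≤e : n ∸ d ≤ e
      n∸d≤e = ≤-trans (∸-monoˡ-≤ d (s≤s⁻¹ (subst (n <_) (sym i≡) n<i))) (≤-reflexive (m+n∸m≡n d e))
    ...   | no n≮i = subst (λ m → w ∋ vertex m) (m+[n∸m]≡n i≤n)
              (in-w₂ (∋-⁀ˡ (proj₁ down) w₃ (proj₂ down {suc (n ∸ i T)} n∸i<j)))
      where
      i≤n : i T ≤ n
      i≤n = ≮⇒≥ n≮i
      n∸i<j : n ∸ i T < j T
      n∸i<j = +-cancelˡ-< (i T) _ _ (subst (_< size T) (sym (m+[n∸m]≡n i≤n)) n<)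

    len : e + suc (j T + (j T + d)) ≡ i T + 2 * j T
    len = trans (lemma d e (j T)) (cong (_+ 2 * j T) i≡)
      where
      lemma : ∀ d e j → e + suc (j + (j + d)) ≡ suc (d + e) + 2 * j
      lemma = solve-∀

-- The infinite tree of locations.

-- The junction is `trunk 0` and the start `trunk d`, so the ray away from the junction
-- consists of the `trunk (d + z)`; the `arm₁ k` and `arm₂ k` sit at distance suc k from the junction.
data Loc : Set where
  trunk arm₁ arm₂ : ℕ → Loc

adjacent : Loc → List Loc
adjacent (trunk zero)    = trunk 1 ∷ arm₁ 0 ∷ arm₂ 0 ∷ []
adjacent (trunk (suc p)) = trunk p ∷ trunk (2 + p) ∷ []
adjacent (arm₁ zero)     = trunk 0 ∷ arm₁ 1 ∷ []
adjacent (arm₁ (suc k))  = arm₁ k ∷ arm₁ (2 + k) ∷ []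
adjacent (arm₂ zero)     = trunk 0 ∷ arm₂ 1 ∷ []
adjacent (arm₂ (suc k))  = arm₂ k ∷ arm₂ (2 + k) ∷ []

tree : (Loc → ℕ) → Network
tree lab .Node  = Loc
tree lab .label = lab
tree lab .nbrs  = adjacent

data Link : Loc → Loc → Set where
  trunk-trunk : ∀ {p} → Link (trunk p) (trunk (suc p))
  trunk-arm₁  : Link (trunk 0) (arm₁ 0)
  trunk-arm₂  : Link (trunk 0) (arm₂ 0)
  arm₁-arm₁   : ∀ {k} → Link (arm₁ k) (arm₁ (suc k))
  arm₂-arm₂   : ∀ {k} → Link (arm₂ k) (arm₂ (suc k))

Linked : Loc → Loc → Set
Linked l l′ = Link l l′ ⊎ Link l′ l

Linked⇒∈ : ∀ {l l′} → Linked l l′ → l′ ∈ adjacent l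
Linked⇒∈ (inj₁ (trunk-trunk {zero}))  = here refl
Linked⇒∈ (inj₁ (trunk-trunk {suc p})) = there (here refl)
Linked⇒∈ (inj₁ trunk-arm₁)            = there (here refl)
Linked⇒∈ (inj₁ trunk-arm₂)            = there (there (here refl))
Linked⇒∈ (inj₁ (arm₁-arm₁ {zero}))    = there (here refl)
Linked⇒∈ (inj₁ (arm₁-arm₁ {suc k}))   = there (here refl)
Linked⇒∈ (inj₁ (arm₂-arm₂ {zero}))    = there (here refl)
Linked⇒∈ (inj₁ (arm₂-arm₂ {suc k}))   = there (here refl)
Linked⇒∈ (inj₂ trunk-trunk)           = here refl
Linked⇒∈ (inj₂ trunk-arm₁)            = here refl
Linked⇒∈ (inj₂ trunk-arm₂)            = here refl
Linked⇒∈ (inj₂ arm₁-arm₁)             = here refl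
Linked⇒∈ (inj₂ arm₂-arm₂)             = here refl

∈⇒Linked : ∀ {l l′} → l′ ∈ adjacent l → Linked l l′
∈⇒Linked {trunk zero}    (here refl)                 = inj₁ trunk-trunk
∈⇒Linked {trunk zero}    (there (here refl))         = inj₁ trunk-arm₁
∈⇒Linked {trunk zero}    (there (there (here refl))) = inj₁ trunk-arm₂
∈⇒Linked {trunk (suc p)} (here refl)                 = inj₂ trunk-trunk
∈⇒Linked {trunk (suc p)} (there (here refl))         = inj₁ trunk-trunk
∈⇒Linked {arm₁ zero}     (here refl)                 = inj₂ trunk-arm₁
∈⇒Linked {arm₁ zero}     (there (here refl))         = inj₁ arm₁-arm₁
∈⇒Linked {arm₁ (suc k)}  (here refl)                 = inj₂ arm₁-arm₁
∈⇒Linked {arm₁ (suc k)}  (there (here refl))         = inj₁ arm₁-arm₁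
∈⇒Linked {arm₂ zero}     (here refl)                 = inj₂ trunk-arm₂
∈⇒Linked {arm₂ zero}     (there (here refl))         = inj₁ arm₂-arm₂
∈⇒Linked {arm₂ (suc k)}  (here refl)                 = inj₂ arm₂-arm₂
∈⇒Linked {arm₂ (suc k)}  (there (here refl))         = inj₁ arm₂-arm₂

adjacent-unique : ∀ l → Unique (adjacent l)
adjacent-unique (trunk zero)    = ((λ ()) ∷ (λ ()) ∷ []) ∷ ((λ ()) ∷ []) ∷ [] ∷ []
adjacent-unique (trunk (suc p)) = ((λ ()) ∷ []) ∷ [] ∷ []
adjacent-unique (arm₁ zero)     = ((λ ()) ∷ []) ∷ [] ∷ []
adjacent-unique (arm₁ (suc k))  = ((λ ()) ∷ []) ∷ [] ∷ []
adjacent-unique (arm₂ zero)     = ((λ ()) ∷ []) ∷ [] ∷ []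
adjacent-unique (arm₂ (suc k))  = ((λ ()) ∷ []) ∷ [] ∷ []

-- The parameters count the nodes kept on the trunk and on the two arms.
Within : ℕ → ℕ → ℕ → Loc → Set
Within c x y (trunk p) = p < c
Within c x y (arm₁ k)  = k < x
Within c x y (arm₂ k)  = k < y

-- One more node on each branch is enough for a tadpole to contain the full neighbourhood of every
-- node `Within c x y`.
Linked-Within : ∀ {c x y l l′} → Within c x y l → Linked l l′ → Within (suc c) (suc x) (suc y) l′
Linked-Within l< (inj₁ trunk-trunk) = s≤s l<
Linked-Within l< (inj₁ trunk-arm₁)  = s≤s z≤n
Linked-Within l< (inj₁ trunk-arm₂)  = s≤s z≤n
Linked-Within l< (inj₁ arm₁-arm₁)   = s≤s l<
Linked-Within l< (inj₁ arm₂-arm₂)   = s≤s l<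
Linked-Within l< (inj₂ trunk-trunk) = m≤n⇒m≤1+n (<⇒≤ l<)
Linked-Within l< (inj₂ trunk-arm₁)  = s≤s z≤n
Linked-Within l< (inj₂ trunk-arm₂)  = s≤s z≤n
Linked-Within l< (inj₂ arm₁-arm₁)   = m≤n⇒m≤1+n (<⇒≤ l<)
Linked-Within l< (inj₂ arm₂-arm₂)   = m≤n⇒m≤1+n (<⇒≤ l<)

-- Tadpoles that are locally indistinguishable from the tree.

-- The tree cut down to `Within (suc c) (suc x) (suc y)`, with the end of the trunk
-- joined to the end of arm₁; the nodes `Within c x y` cannot tell the difference.
module World (c x y : ℕ) (0<c : 0 < c) where

  I : ℕ
  I = suc c + suc x

  -- The cycle indices run up the trunk from 0 to `c` and then down arm₁ from `x` to 0, which closes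
  -- up at the junction; arm₂ is the stem. Equations replace truncated subtractions.
  data At : ℕ → Loc → Set where
    at-trunk : ∀ {p} → p ≤ c → At p (trunk p)
    at-arm₁  : ∀ {k n} → k ≤ x → suc (n + k) ≡ I → At n (arm₁ k)
    at-arm₂  : ∀ {k n} → k ≤ y → n ≡ I + k → At n (arm₂ k)

  place : ℕ → Loc
  place n with n ≤? c | n <? I
  ... | yes _ | _     = trunk n
  ... | no _  | yes _ = arm₁ (I ∸ suc n)
  ... | no _  | no _  = arm₂ (n ∸ I)

  place-At : ∀ {n} → n < I + suc y → At n (place n)
  place-At {n} n< with n ≤? c | n <? I
  ... | yes n≤c | _ = at-trunk n≤c
  ... | no n≰c | yes n<I = at-arm₁ I∸n≤x (m+[n∸m]≡n n<I)
    where
    I∸n≤x : I ∸ suc n ≤ x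
    I∸n≤x = ≤-trans (∸-monoʳ-≤ I (s≤s (≰⇒> n≰c)))
              (≤-reflexive (trans (cong (_∸ (2 + c)) (+-suc (suc c) x)) (m+n∸m≡n c x)))
  ... | no n≰c | no n≮I = at-arm₂ n∸I≤y (sym (m+[n∸m]≡n I≤n))
    where
    I≤n = ≮⇒≥ n≮I
    n∸I≤y : n ∸ I ≤ y
    n∸I≤y = s≤s⁻¹ (+-cancelˡ-< I _ _ (subst (_< I + suc y) (sym (m+[n∸m]≡n I≤n)) n<))

  At-injective : ∀ {m n l} → At m l → At n l → m ≡ n
  At-injective (at-trunk _) (at-trunk _) = refl
  At-injective {m} {n} (at-arm₁ {k} _ e) (at-arm₁ _ e′) = +-cancelʳ-≡ k m n (suc-injective (trans e (sym e′)))
  At-injective (at-arm₂ _ e) (at-arm₂ _ e′) = trans e (sym e′)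

  at-arm₁-> : ∀ {k n} → k ≤ x → suc (n + k) ≡ I → c < n
  at-arm₁-> {k} {n} k≤x e = +-cancelʳ-< x c n (begin-strict
    c + x       <⟨ ≤-refl ⟩
    suc c + x   ≡⟨ suc-injective (trans (sym (+-suc (suc c) x)) (sym e)) ⟩
    n + k       ≤⟨ +-monoʳ-≤ n k≤x ⟩
    n + x       ∎)
    where open ≤-Reasoning

  at-arm₁-< : ∀ {k n} → suc (n + k) ≡ I → n < I
  at-arm₁-< {k} {n} e = subst (n <_) e (s≤s (m≤m+n n k))

  c<I : c < I
  c<I = s≤s (m≤m+n c (suc x))

  at-arm₂-≥ : ∀ {k n} → n ≡ I + k → I ≤ n
  at-arm₂-≥ {k} refl = m≤m+n I k

  At-functional : ∀ {n l l′} → At n l → At n l′ → l ≡ l′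
  At-functional (at-trunk _) (at-trunk _) = refl
  At-functional (at-trunk p≤c) (at-arm₁ k≤x e) = contradiction p≤c (<⇒≱ (at-arm₁-> k≤x e))
  At-functional (at-trunk p≤c) (at-arm₂ _ e) = contradiction (at-arm₂-≥ e) (<⇒≱ (≤-<-trans p≤c c<I))
  At-functional (at-arm₁ k≤x e) (at-trunk p≤c) = contradiction p≤c (<⇒≱ (at-arm₁-> k≤x e))
  At-functional {n} (at-arm₁ _ e) (at-arm₁ _ e′) = cong arm₁ (+-cancelˡ-≡ n _ _ (suc-injective (trans e (sym e′))))
  At-functional (at-arm₁ _ e) (at-arm₂ _ e′) = contradiction (at-arm₂-≥ e′) (<⇒≱ (at-arm₁-< e))
  At-functional (at-arm₂ _ e) (at-trunk p≤c) = contradiction (at-arm₂-≥ e) (<⇒≱ (≤-<-trans p≤c c<I))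
  At-functional (at-arm₂ _ e) (at-arm₁ _ e′) = contradiction (at-arm₂-≥ e) (<⇒≱ (at-arm₁-< e′))
  At-functional (at-arm₂ _ e) (at-arm₂ _ e′) = cong arm₂ (+-cancelˡ-≡ I _ _ (trans (sym e) e′))

  Within⇒At : ∀ {l} → Within (suc c) (suc x) (suc y) l → ∃ λ n → n < I + suc y × At n l
  Within⇒At {trunk p} p< = p , ≤-trans (≤-trans p< (m≤m+n (suc c) (suc x))) (m≤m+n I (suc y)) , at-trunk (s≤s⁻¹ p<)
  Within⇒At {arm₁ k} k< = I ∸ suc k , ≤-trans (at-arm₁-< e) (m≤m+n I (suc y)) , at-arm₁ (s≤s⁻¹ k<) e
    where
    e : suc (I ∸ suc k + k) ≡ I
    e = trans (sym (+-suc _ k)) (m∸n+n≡m (≤-trans k< (m≤n+m (suc x) (suc c))))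
  Within⇒At {arm₂ k} k< = I + k , +-monoʳ-< I k< , at-arm₂ (s≤s⁻¹ k<) refl

  -- The only edge foreign to the tree is the one joining `trunk c` to `arm₁ x`, and neither of its
  -- ends is `Within c x y`.
  Edge⇒Linked : ∀ {a b l l′} → Edge I a b → At a l → At b l′ → Within c x y l ⊎ Within c x y l′ → Linked l l′
  Edge⇒Linked (cycle-edge _) (at-trunk {p} p≤c) r′ w with m≤n⇒m<n∨m≡n p≤c
  ... | inj₁ p<c with refl ← At-functional r′ (at-trunk p<c) = inj₁ trunk-trunk
  ... | inj₂ refl with refl ← At-functional r′ (at-arm₁ {x} ≤-refl (sym (+-suc (suc c) x))) =
          [ (λ c<c → contradiction c<c (n≮n c)) , (λ x<x → contradiction x<x (n≮n x)) ]′ w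
  Edge⇒Linked {a} (cycle-edge a<) (at-arm₁ {zero} _ e) r′ w =
    contradiction a< (<-irrefl (trans (cong suc (sym (+-identityʳ a))) e))
  Edge⇒Linked {a} (cycle-edge a<) (at-arm₁ {suc k} k< e) r′ w
    with refl ← At-functional r′ (at-arm₁ {k} (<⇒≤ k<) (trans (cong suc (sym (+-suc a k))) e)) = inj₂ arm₁-arm₁
  Edge⇒Linked (cycle-edge a<) (at-arm₂ _ e) r′ w = contradiction (at-arm₂-≥ e) (<⇒≱ (<⇒≤ a<))
  Edge⇒Linked {a} (closing-edge e) r r′ w
    with refl ← At-functional r (at-arm₁ {0} z≤n (trans (cong suc (+-identityʳ a)) e))
       | refl ← At-functional r′ (at-trunk z≤n) = inj₂ trunk-arm₁
  Edge⇒Linked first-stem r r′ w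
    with refl ← At-functional r (at-trunk z≤n)
       | refl ← At-functional r′ (at-arm₂ {0} z≤n (sym (+-identityʳ I))) = inj₁ trunk-arm₂
  Edge⇒Linked (stem-edge I≤a) (at-trunk p≤c) r′ w = contradiction I≤a (<⇒≱ (≤-<-trans p≤c c<I))
  Edge⇒Linked (stem-edge I≤a) (at-arm₁ _ e) r′ w = contradiction I≤a (<⇒≱ (at-arm₁-< e))
  Edge⇒Linked (stem-edge I≤a) (at-arm₂ _ _) (at-trunk p≤c) w = contradiction (m≤n⇒m≤1+n I≤a) (<⇒≱ (≤-<-trans p≤c c<I))
  Edge⇒Linked (stem-edge I≤a) (at-arm₂ _ _) (at-arm₁ _ e) w = contradiction (m≤n⇒m≤1+n I≤a) (<⇒≱ (at-arm₁-< e))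
  Edge⇒Linked (stem-edge I≤a) (at-arm₂ {k} _ refl) (at-arm₂ {k′} _ e) w
    with refl ← +-cancelˡ-≡ I (suc k) k′ (trans (+-suc I k) e) = inj₁ arm₂-arm₂

  Link⇒Edge : ∀ {a b l l′} → Link l l′ → At a l → At b l′ → Edge I a b ⊎ Edge I b a
  Link⇒Edge trunk-trunk (at-trunk _) (at-trunk p<c) = inj₁ (cycle-edge (≤-<-trans p<c c<I))
  Link⇒Edge {b = b} trunk-arm₁ (at-trunk _) (at-arm₁ _ e) =
    inj₂ (closing-edge (trans (cong suc (sym (+-identityʳ b))) e))
  Link⇒Edge trunk-arm₂ (at-trunk _) (at-arm₂ _ refl) = inj₁ (subst (Edge I 0) (sym (+-identityʳ I)) first-stem)
  Link⇒Edge {a} {b} arm₁-arm₁ (at-arm₁ {k} _ e) (at-arm₁ _ e′)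
    with refl ← +-cancelʳ-≡ k a (suc b) (suc-injective (trans e (trans (sym e′) (cong suc (+-suc b k))))) =
      inj₂ (cycle-edge (at-arm₁-< e))
  Link⇒Edge arm₂-arm₂ (at-arm₂ {k} _ refl) (at-arm₂ _ refl) =
    inj₁ (subst (Edge I (I + k)) (sym (+-suc I k)) (stem-edge (m≤m+n I k)))

  module Labelled (lab : Loc → ℕ) (lab-injective : ∀ {l l′} → lab l ≡ lab l′ → l ≡ l′) where

    placeᶠ : Fin (I + suc y) → Loc
    placeᶠ v = place (toℕ v)

    placeᶠ-injective : ∀ {v w} → placeᶠ v ≡ placeᶠ w → v ≡ w
    placeᶠ-injective {v} {w} e = toℕ-injective
      (At-injective (place-At (toℕ<n v)) (subst (At (toℕ w)) (sym e) (place-At (toℕ<n w))))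

    world : Tadpole
    world .i = I
    world .j = suc y
    world .i≥3 = subst (3 ≤_) (sym (+-suc (suc c) x)) (s≤s (s≤s (m≤n⇒m≤n+o x 0<c)))
    world .j≥1 = s≤s z≤n
    world .ids = Vec.tabulate (lab ∘ placeᶠ)
    world .ids-injective v w e = placeᶠ-injective (lab-injective
      (trans (sym (lookup∘tabulate (lab ∘ placeᶠ) v)) (trans e (lookup∘tabulate (lab ∘ placeᶠ) w))))

    label-place : ∀ v → lab (placeᶠ v) ≡ idOf world v
    label-place v = sym (lookup∘tabulate (lab ∘ placeᶠ) v)

    Adj⇒Linked : ∀ {v w} → Within c x y (placeᶠ v) → Adj world v w ≡ true → Linked (placeᶠ v) (placeᶠ w)
    Adj⇒Linked {v} {w} v-in e with Adj⇒Edge world {v} {w} e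
    ... | inj₁ e′ = Edge⇒Linked e′ (place-At (toℕ<n v)) (place-At (toℕ<n w)) (inj₁ v-in)
    ... | inj₂ e′ = Sum.swap (Edge⇒Linked e′ (place-At (toℕ<n w)) (place-At (toℕ<n v)) (inj₂ v-in))

    At-vertex : ∀ {n l} → n < I + suc y → At n l → placeᶠ (vertex world n) ≡ l
    At-vertex {n} n< r = trans (cong place (toℕ-vertex world n<)) (At-functional (place-At n<) r)

    Linked⇒Adj : ∀ {v l} → Within c x y (placeᶠ v) → Linked (placeᶠ v) l →
                 ∃ λ w → Adj world v w ≡ true × placeᶠ w ≡ l
    Linked⇒Adj {v} v-in e with Within⇒At (Linked-Within v-in e)
    ... | n , n< , r = vertex world n , Edge⇒Adj world
            (subst (λ m → Edge I (toℕ v) m ⊎ Edge I m (toℕ v)) (sym (toℕ-vertex world n<)) (edge e)) , At-vertex n< r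
      where
      edge : Linked (placeᶠ v) _ → Edge I (toℕ v) n ⊎ Edge I n (toℕ v)
      edge (inj₁ e′) = Link⇒Edge e′ (place-At (toℕ<n v)) r
      edge (inj₂ e′) = Sum.swap (Link⇒Edge e′ r (place-At (toℕ<n v)))

    -- Both lists are free of duplicates, the first because `placeᶠ` is injective, so having the
    -- same elements makes them permutations of each other.
    place-local : ∀ v → Within c x y (placeᶠ v) → map placeᶠ (nbrs (network world) v) ↭ adjacent (placeᶠ v)
    place-local v v-in = ∼bag⇒↭ (unique∧set⇒bag
      (Uniqueₚ.map⁺ placeᶠ-injective (nbrs-unique world v)) (adjacent-unique (placeᶠ v)) (mk⇔ to from))
      where
      to : ∀ {l} → l ∈ map placeᶠ (nbrs (network world) v) → l ∈ adjacent (placeᶠ v)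
      to l∈ with ∈-map⁻ placeᶠ l∈
      ... | w , w∈ , refl = Linked⇒∈ (Adj⇒Linked {v} {w} v-in (∈nbrs⇒Adj world {v} w∈))
      from : ∀ {l} → l ∈ adjacent (placeᶠ v) → l ∈ map placeᶠ (nbrs (network world) v)
      from l∈ with Linked⇒Adj {v} v-in (∈⇒Linked l∈)
      ... | w , e , refl = ∈-map⁺ placeᶠ (Adj⇒∈nbrs world {v} e)

    module LiftWorld {A : Algorithm} =
      Lift {A} {tree lab} {network world} placeᶠ label-place (Within c x y) place-local

-- Symmetry of the arms and arithmetic for the game.

Within-mono : ∀ {c x y c′ x′ y′} → c ≤ c′ → x ≤ x′ → y ≤ y′ → ∀ {l} → Within c x y l → Within c′ x′ y′ l
Within-mono c≤ _ _ {trunk _} l< = ≤-trans l< c≤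
Within-mono _ x≤ _ {arm₁ _}  l< = ≤-trans l< x≤
Within-mono _ _ y≤ {arm₂ _}  l< = ≤-trans l< y≤

-- The symmetry by which arm₁ may always be taken as the branch that closes the cycle.
swapArms : Loc → Loc
swapArms (trunk p) = trunk p
swapArms (arm₁ k)  = arm₂ k
swapArms (arm₂ k)  = arm₁ k

swapArms-involutive : ∀ l → swapArms (swapArms l) ≡ l
swapArms-involutive (trunk p) = refl
swapArms-involutive (arm₁ k)  = refl
swapArms-involutive (arm₂ k)  = refl

swapArms-adjacent : ∀ l → map swapArms (adjacent l) ↭ adjacent (swapArms l)
swapArms-adjacent (trunk zero)    = prep _ (swap _ _ ↭-refl)
swapArms-adjacent (trunk (suc p)) = ↭-refl
swapArms-adjacent (arm₁ zero)     = ↭-refl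
swapArms-adjacent (arm₁ (suc k))  = ↭-refl
swapArms-adjacent (arm₂ zero)     = ↭-refl
swapArms-adjacent (arm₂ (suc k))  = ↭-refl

swapArms-Within : ∀ {c x y} l → Within c x y (swapArms l) → Within c y x l
swapArms-Within (trunk p) l< = l<
swapArms-Within (arm₁ k)  l< = l<
swapArms-Within (arm₂ k)  l< = l<

Injective : (Loc → ℕ) → Set
Injective lab = ∀ {l l′} → lab l ≡ lab l′ → l ≡ l′

involutive⇒injective : (π : Loc → Loc) → (∀ l → π (π l) ≡ l) → ∀ {l l′} → π l ≡ π l′ → l ≡ l′
involutive⇒injective π inv {l} {l′} e = trans (sym (inv l)) (trans (cong π e) (inv l′))

∣suc-∣≤ : ∀ m n → ∣ suc m - n ∣ ≤ suc ∣ m - n ∣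
∣suc-∣≤ zero zero = ≤-refl
∣suc-∣≤ zero (suc n) = m≤n⇒m≤1+n (n≤1+n n)
∣suc-∣≤ (suc m) zero = ≤-refl
∣suc-∣≤ (suc m) (suc n) = ∣suc-∣≤ m n

∣-∣≤∣suc-∣ : ∀ m n → ∣ m - n ∣ ≤ suc ∣ suc m - n ∣
∣-∣≤∣suc-∣ zero zero = z≤n
∣-∣≤∣suc-∣ zero (suc n) = ≤-refl
∣-∣≤∣suc-∣ (suc m) zero = m≤n⇒m≤1+n (n≤1+n (suc m))
∣-∣≤∣suc-∣ (suc m) (suc n) = ∣-∣≤∣suc-∣ m n

∣m+n-m∣≡n : ∀ m n → ∣ m + n - m ∣ ≡ n
∣m+n-m∣≡n m n = trans (∣-∣-comm (m + n) m) (∣m-m+n∣≡n m n)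

-- Adding c to both sides leaves two semiring identities for the solver.
linear : ∀ {l r a b} c → l ≤ r → l ≡ a + c → r ≡ b + c → a ≤ b
linear {a = a} {b} c l≤r refl refl = +-cancelʳ-≤ c a b l≤r

-- Preserves the invariant over a move along a new edge: it leads one deeper, so both sides grow by
-- two.
double-step : ∀ {n n′ t h h′} → 2 * n ≤ t + h → n′ ≡ suc n → h′ ≡ suc h → 2 * n′ ≤ suc t + h′
double-step {n} {_} {t} {h} inv refl refl =
  linear 0 (+-monoʳ-≤ 2 inv) (lhs n) (rhs t h)
  where
  lhs : ∀ n → 2 + 2 * n ≡ 2 * suc n + 0
  lhs = solve-∀
  rhs : ∀ t h → 2 + (t + h) ≡ suc t + suc h + 0
  rhs = solve-∀

-- Preserves the invariant over a move inside the explored subtree: the depth lost is at most the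
-- move gained.
stay-step : ∀ {n t h h′} → 2 * n ≤ t + h → h ≤ suc h′ → 2 * n ≤ suc t + h′
stay-step {n} {t} {h} {h′} inv h≤ = begin
  2 * n        ≤⟨ inv ⟩
  t + h        ≤⟨ +-monoʳ-≤ t h≤ ⟩
  t + suc h′   ≡⟨ +-suc t h′ ⟩
  suc t + h′   ∎
  where open ≤-Reasoning

-- The adversary: states of the game, and play once the junction is seen.

module Adversary (A : Algorithm) (d : ℕ) where

  depth : Loc → ℕ
  depth (trunk p) = ∣ p - d ∣
  depth (arm₁ k)  = suc (d + k)
  depth (arm₂ k)  = suc (d + k)

  depth-Link : ∀ {l l′} → Link l l′ → depth l ≤ suc (depth l′) × depth l′ ≤ suc (depth l)
  depth-Link (trunk-trunk {p}) = ∣-∣≤∣suc-∣ p d , ∣suc-∣≤ p d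
  depth-Link trunk-arm₁ = ≤-trans (m≤m+n d 0) (m≤n⇒m≤1+n (n≤1+n _)) , s≤s (≤-reflexive (+-identityʳ d))
  depth-Link trunk-arm₂ = ≤-trans (m≤m+n d 0) (m≤n⇒m≤1+n (n≤1+n _)) , s≤s (≤-reflexive (+-identityʳ d))
  depth-Link (arm₁-arm₁ {k}) = m≤n⇒m≤1+n (s≤s (+-monoʳ-≤ d (n≤1+n k))) , s≤s (≤-reflexive (+-suc d k))
  depth-Link (arm₂-arm₂ {k}) = m≤n⇒m≤1+n (s≤s (+-monoʳ-≤ d (n≤1+n k))) , s≤s (≤-reflexive (+-suc d k))

  depth-Linked : ∀ {l l′} → Linked l l′ → depth l ≤ suc (depth l′)
  depth-Linked (inj₁ e) = proj₁ (depth-Link e)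
  depth-Linked (inj₂ e) = proj₂ (depth-Link e)

  -- Covers both stopping and naming an identifier that no neighbour carries.
  Stuck : (lab : Loc → ℕ) → Loc → List Loc → Set
  Stuck lab l ls = ∀ {l′} → l′ ∈ adjacent l → A (obsHistory (tree lab) (l ∷ ls)) ≢ just (lab l′)

  next-move : ∀ lab l ls → Stuck lab l ls ⊎
              ∃ λ l′ → l′ ∈ adjacent l × A (obsHistory (tree lab) (l ∷ ls)) ≡ just (lab l′)
  next-move lab l ls with any? (λ l′ → ≡-dec _≟_ (A (obsHistory (tree lab) (l ∷ ls))) (just (lab l′))) (adjacent l)
  ... | yes found = inj₂ (find found)
  ... | no ¬found = inj₁ (λ l′∈ e → ¬found (lose l′∈ e))

  -- Twice the largest optimum that can arise, so a searcher that has made this many moves has already lost.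
  patience : ℕ
  patience = 8 * d + 10

  -- In `trapped` the explored subtree has `2d + y` edges, since `x + z` is `d`. At the tip of arm₁,
  -- of depth `d + x`, twice the edges minus the depth is `3d + 2y - x`, stated here without
  -- subtraction; the tip of the ray is less deep and satisfies the same bound.
  data Verdict (lab : Loc → ℕ) (x y z : ℕ) (l : Loc) (ls : List Loc) : Set where
    stuck   : Stuck lab l ls → Verdict lab x y z l ls
    late    : patience ≤ length ls → Verdict lab x y z l ls
    trapped : x + z ≡ d → 3 * d + 2 * y ≤ length ls + x →
              (∃ λ k → x ≡ suc k × l ≡ arm₁ k) ⊎ l ≡ trunk (d + z) → Verdict lab x y z l ls

  -- The labelling is part of the result because swapping the arms and reflecting the trunk relabel
  -- the tree in hindsight.
  record Outcome : Set where
    constructor outcome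
    field
      lab : Loc → ℕ
      lab-injective : Injective lab
      {x y z} : ℕ
      {l} : Loc
      {ls} : List Loc
      run : Run A (tree lab) (trunk d) (l ∷ ls)
      within : All (Within (suc (d + z)) x y) (l ∷ ls)
      x+z≤d : x + z ≤ d
      y≤d : y ≤ d
      verdict : Verdict lab x y z l ls

  -- A searcher at depth h whose visited nodes form a subtree with n edges has made at
  -- least 2n - h moves.
  record Explored (x y z : ℕ) (l : Loc) (t : ℕ) : Set where
    constructor explored
    field
      lab : Loc → ℕ
      lab-injective : Injective lab
      {ls} : List Loc
      run : Run A (tree lab) (trunk d) (l ∷ ls)
      within : All (Within (suc (d + z)) x y) (l ∷ ls)
      moves : length ls ≡ t
      effort : 2 * (d + z + x + y) ≤ t + depth l

  -- Swapping the arms is an automorphism of the whole tree, so the run lifts with the trivial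
  -- predicate.
  swapExplored : ∀ {x y z l t} → Explored x y z l t → Explored y x z (swapArms l) t
  swapExplored {x} {y} {z} {t = t} (explored lab inj run (p ∷ ps) moves effort)
    with Lift.lift {G = tree lab} {H = tree (lab ∘ swapArms)} swapArms (λ _ → refl) (λ _ → ⊤)
           (λ l _ → swapArms-adjacent l) {s = trunk d} (All.universal (λ _ → tt) _) run
  ... | l , ls , refl , refl , run′ rewrite swapArms-involutive l =
    explored (lab ∘ swapArms) (involutive⇒injective swapArms swapArms-involutive ∘ inj) run′
      (All.map (λ {l} → swapArms-Within l) (p ∷ Allₚ.map⁻ ps)) (trans (sym (length-map swapArms ls)) moves)
      (subst₂ (λ n h → 2 * n ≤ t + h) (lemma d z x y) (depth-swapArms l) effort)
    where
    lemma : ∀ d z x y → d + z + x + y ≡ d + z + y + x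
    lemma = solve-∀
    depth-swapArms : ∀ l → depth (swapArms l) ≡ depth l
    depth-swapArms (trunk _) = refl
    depth-swapArms (arm₁ _)  = refl
    depth-swapArms (arm₂ _)  = refl

  -- The explored part is left only at one of its three ends, and then the depth grows by one,
  -- recorded as `double-step` expects it.
  data Step (x y z : ℕ) (l : Loc) : Loc → Set where
    inside : ∀ {l′} → Within (suc (d + z)) x y l′ → Step x y z l l′
    fresh₁ : suc (d + x) ≡ suc (depth l) → Step x y z l (arm₁ x)
    fresh₂ : suc (d + y) ≡ suc (depth l) → Step x y z l (arm₂ y)
    fresh₀ : ∣ suc (d + z) - d ∣ ≡ suc (depth l) → Step x y z l (trunk (suc (d + z)))

  step : ∀ {x y z l l′} → Within (suc (d + z)) x y l → Linked l l′ → Step x y z l l′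
  step {z = z} l< (inj₁ trunk-trunk) with m≤n⇒m<n∨m≡n (s≤s⁻¹ l<)
  ... | inj₁ p< = inside (s≤s p<)
  ... | inj₂ refl = fresh₀ (trans (trans (cong (λ n → ∣ n - d ∣) (sym (+-suc d z))) (∣m+n-m∣≡n d (suc z)))
                             (cong suc (sym (∣m+n-m∣≡n d z))))
  step {zero}  _ (inj₁ trunk-arm₁) = fresh₁ (cong suc (+-identityʳ d))
  step {suc _} _ (inj₁ trunk-arm₁) = inside (s≤s z≤n)
  step {y = zero}  _ (inj₁ trunk-arm₂) = fresh₂ (cong suc (+-identityʳ d))
  step {y = suc _} _ (inj₁ trunk-arm₂) = inside (s≤s z≤n)
  step l< (inj₁ (arm₁-arm₁ {k})) with m≤n⇒m<n∨m≡n l<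
  ... | inj₁ k< = inside k<
  ... | inj₂ refl = fresh₁ (cong suc (+-suc d k))
  step l< (inj₁ (arm₂-arm₂ {k})) with m≤n⇒m<n∨m≡n l<
  ... | inj₁ k< = inside k<
  ... | inj₂ refl = fresh₂ (cong suc (+-suc d k))
  step l< (inj₂ trunk-trunk) = inside (<⇒≤ l<)
  step l< (inj₂ trunk-arm₁) = inside (s≤s z≤n)
  step l< (inj₂ trunk-arm₂) = inside (s≤s z≤n)
  step l< (inj₂ arm₁-arm₁) = inside (<⇒≤ l<)
  step l< (inj₂ arm₂-arm₂) = inside (<⇒≤ l<)

  trap₁ : ∀ {x y z t} → Explored (suc x) y z (arm₁ x) t → suc x + z ≡ d → y ≤ d → Outcome
  trap₁ {x} {y} {z} {t} (explored lab inj run within refl effort) refl y≤d =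
    outcome lab inj run within ≤-refl y≤d
      (trapped refl (linear (suc x + z) effort (lhs x y z) (rhs x z t)) (inj₁ (x , refl , refl)))
    where
    lhs : ∀ x y z → 2 * ((suc x + z) + z + suc x + y) ≡ 3 * (suc x + z) + 2 * y + (suc x + z)
    lhs = solve-∀
    rhs : ∀ x z t → t + suc ((suc x + z) + x) ≡ t + suc x + (suc x + z)
    rhs = solve-∀

  trap₀ : ∀ {x y z t} → Explored x y z (trunk (d + z)) t → x + z ≡ d → y ≤ d → Outcome
  trap₀ {x} {y} {z} {t} (explored lab inj run within refl effort) refl y≤d =
    outcome lab inj run within ≤-refl y≤d
      (trapped refl (linear (x + z) (≤-trans effort (+-monoʳ-≤ t depth≤)) (lhs x y z) (rhs x z t)) (inj₂ refl))
    where
    -- The ray's tip has depth only `z`; adding `2 * x` weakens this to the inequality shared with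
    -- the tip of arm₁.
    depth≤ : ∣ x + z + z - x + z ∣ ≤ 2 * x + z
    depth≤ = ≤-trans (≤-reflexive (∣m+n-m∣≡n (x + z) z)) (m≤n+m z (2 * x))
    lhs : ∀ x y z → 2 * ((x + z) + z + x + y) ≡ 3 * (x + z) + 2 * y + (x + z)
    lhs = solve-∀
    rhs : ∀ x z t → t + (2 * x + z) ≡ t + x + (x + z)
    rhs = solve-∀

  -- The fuel `f` is what remains of `patience`. The strict inequalities say that no cycle may be
  -- closed yet; a move raises at most one extent, by one, so a cycle is closed exactly at equality.
  search : ∀ f {x y z l t} → Explored x y z l t → x + z < d → y + z < d → patience ≤ t + f → Outcome
  search zero {x} {y} {z} {t = t} (explored lab inj run within moves _) x< y< p≤ =
    outcome lab inj run within (<⇒≤ x<) (m+n≤o⇒m≤o y (<⇒≤ y<))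
      (late (≤-trans p≤ (≤-reflexive (trans (+-identityʳ t) (sym moves)))))
  search (suc f) {x} {y} {z} {l} {t} (explored lab inj {ls} run within@(w ∷ _) refl effort) x< y< p≤
    with next-move lab l ls
  ... | inj₁ s = outcome lab inj run within (<⇒≤ x<) (m+n≤o⇒m≤o y (<⇒≤ y<)) (stuck s)
  ... | inj₂ (l′ , l′∈ , a) = dispatch (step w (∈⇒Linked l′∈))
    where
    p≤′ : patience ≤ suc t + f
    p≤′ = ≤-trans p≤ (≤-reflexive (+-suc t f))

    next : ∀ {x′ y′ z′} → z ≤ z′ → x ≤ x′ → y ≤ y′ → Within (suc (d + z′)) x′ y′ l′ →
           2 * (d + z′ + x′ + y′) ≤ suc t + depth l′ → Explored x′ y′ z′ l′ (suc t)
    next z≤ x≤ y≤ w′ effort′ = explored lab inj (move l′ run a l′∈)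
      (w′ ∷ All.map (Within-mono (s≤s (+-monoʳ-≤ d z≤)) x≤ y≤) within) refl effort′

    -- Generic in `x` and `y`, so that progress on arm₂ is treated by the same argument after
    -- swapping the arms.
    after-arm : ∀ {x y t′} → Explored (suc x) y z (arm₁ x) t′ → x + z < d → y + z < d → patience ≤ t′ + f → Outcome
    after-arm {x} {y} E x< y< p≤ with m≤n⇒m<n∨m≡n x<
    ... | inj₁ sx< = search f E sx< y< p≤
    ... | inj₂ sx≡ = trap₁ E sx≡ (m+n≤o⇒m≤o y (<⇒≤ y<))

    after-trunk : Explored x y (suc z) (trunk (d + suc z)) (suc t) → Outcome
    after-trunk E with m≤n⇒m<n∨m≡n (subst (_≤ d) (sym (+-suc x z)) x<) | m≤n⇒m<n∨m≡n (subst (_≤ d) (sym (+-suc y z)) y<)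
    ... | inj₂ x≡ | _ = trap₀ E x≡ (m+n≤o⇒m≤o y (<⇒≤ y<))
    ... | inj₁ _ | inj₂ y≡ = trap₀ (swapExplored E) y≡ (m+n≤o⇒m≤o x (<⇒≤ x<))
    ... | inj₁ x<′ | inj₁ y<′ = search f E x<′ y<′ p≤′

    dispatch : Step x y z l l′ → Outcome
    dispatch (inside w′) = search f (next ≤-refl ≤-refl ≤-refl w′
      (stay-step {d + z + x + y} effort (depth-Linked (∈⇒Linked l′∈)))) x< y< p≤′
    dispatch (fresh₁ h) = after-arm (next ≤-refl (n≤1+n x) ≤-refl (n<1+n x)
      (double-step effort (cong (_+ y) (+-suc (d + z) x)) h)) x< y< p≤′
    dispatch (fresh₂ h) = after-arm (swapExplored (next ≤-refl ≤-refl (n≤1+n y) (n<1+n y)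
      (double-step effort (+-suc (d + z + x) y) h))) y< x< p≤′
    dispatch (fresh₀ h) = after-trunk (subst (λ p → Explored x y (suc z) (trunk p) (suc t)) (sym (+-suc d z))
      (next (n≤1+n z) ≤-refl ≤-refl (s≤s (≤-reflexive (sym (+-suc d z))))
        (double-step effort (cong (λ n → n + x + y) (+-suc d z)) h)))

  -- The adversary: play before the junction is seen.

  -- As long as the junction is hidden, relabelling by this reflection in `trunk d` is
  -- unnoticeable, so the junction can be put on the side that is followed to depth d first.
  mirror : Loc → Loc
  mirror (trunk p) with p ≤? d + d
  ... | yes _ = trunk (d + d ∸ p)
  ... | no  _ = trunk p
  mirror (arm₁ k) = arm₁ k
  mirror (arm₂ k) = arm₂ k

  mirror-trunk : ∀ {p r} → p + r ≡ d + d → mirror (trunk p) ≡ trunk r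
  mirror-trunk {p} {r} e with p ≤? d + d
  ... | yes _ = cong trunk (trans (cong (_∸ p) (sym e)) (m+n∸m≡n p r))
  ... | no p≰ = contradiction (subst (p ≤_) e (m≤m+n p r)) p≰

  mirror-far : ∀ {p} → d + d < p → mirror (trunk p) ≡ trunk p
  mirror-far {p} p> with p ≤? d + d
  ... | yes p≤ = contradiction p> (≤⇒≯ p≤)
  ... | no _ = refl

  reflected : ∀ p → (∃ λ r → p + r ≡ d + d) ⊎ d + d < p
  reflected p with ≤-<-connex p (d + d)
  ... | inj₁ p≤ = inj₁ (d + d ∸ p , m+[n∸m]≡n p≤)
  ... | inj₂ p> = inj₂ p>

  mirror-involutive : ∀ l → mirror (mirror l) ≡ l
  mirror-involutive (trunk p) with reflected p
  ... | inj₁ (r , e) = trans (cong mirror (mirror-trunk e)) (mirror-trunk (trans (+-comm r p) e))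
  ... | inj₂ p> = trans (cong mirror (mirror-far p>)) (mirror-far p>)
  mirror-involutive (arm₁ k) = refl
  mirror-involutive (arm₂ k) = refl

  -- The trunk interval from `d - w` to `d + z`: `w` is the extent explored towards the junction,
  -- `z` the extent away from it.
  Mid : ℕ → ℕ → Loc → Set
  Mid w z (trunk p) = d ≤ p + w × p ≤ d + z
  Mid w z (arm₁ _)  = ⊥
  Mid w z (arm₂ _)  = ⊥

  Mid-mono : ∀ {w z w′ z′} → w ≤ w′ → z ≤ z′ → ∀ {l} → Mid w z l → Mid w′ z′ l
  Mid-mono w≤ z≤ {trunk p} (lo , hi) = ≤-trans lo (+-monoʳ-≤ p w≤) , ≤-trans hi (+-monoʳ-≤ d z≤)

  Mid⇒Within : ∀ {w z l} → Mid w z l → Within (suc (d + z)) 0 0 l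
  Mid⇒Within {l = trunk p} (_ , hi) = s≤s hi

  Mid-positive : ∀ {w z p} → w < d → Mid w z (trunk p) → 0 < p
  Mid-positive {p = zero} w<d (lo , _) = contradiction w<d (≤⇒≯ lo)
  Mid-positive {p = suc _} _ _ = s≤s z≤n

  -- The reflection exchanges the two extents; `z < d` keeps the interval inside the range that
  -- `mirror` reflects.
  mirror-Mid : ∀ {w z} → z < d → ∀ {l} → Mid w z (mirror l) → Mid z w l
  mirror-Mid {w} {z} z<d {trunk q} m with reflected q
  ... | inj₁ (r , e) = bounds (subst (Mid w z) (mirror-trunk e) m)
    where
    bounds : d ≤ r + w × r ≤ d + z → d ≤ q + z × q ≤ d + w
    bounds (lo , hi) =
      linear (r + d) (+-monoʳ-≤ (d + d) hi) (sum₁ d r) (trans (cong (_+ (d + z)) (sym e)) (sum₂ q r d z)) ,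
      linear (r + d) (+-monoʳ-≤ (d + d) lo) (trans (cong (_+ d) (sym e)) (+-assoc q r d)) (sum₃ d r w)
      where
      sum₁ : ∀ d r → d + d + r ≡ d + (r + d)
      sum₁ = solve-∀
      sum₂ : ∀ q r d z → q + r + (d + z) ≡ q + z + (r + d)
      sum₂ = solve-∀
      sum₃ : ∀ d r w → d + d + (r + w) ≡ d + w + (r + d)
      sum₃ = solve-∀
  ... | inj₂ q> = contradiction (proj₂ (subst (Mid w z) (mirror-far q>) m))
                    (<⇒≱ (<-trans (+-monoʳ-< d z<d) q>))

  -- `mirror` fails to respect adjacency at the junction and at its image `trunk (d + d)`. Both
  -- extents being below `d` keeps a node and its reflection away from these, where each has just
  -- two trunk neighbours, exchanged by the reflection.
  mirror-local : ∀ {w z} → w < d → z < d → ∀ l → Mid w z (mirror l) → map mirror (adjacent l) ↭ adjacent (mirror l)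
  mirror-local {w} {z} w<d z<d (trunk q) m with reflected q
  ... | inj₂ q> = contradiction (proj₂ (subst (Mid w z) (mirror-far q>) m))
                    (<⇒≱ (<-trans (+-monoʳ-< d z<d) q>))
  ... | inj₁ (r , e) = at-pair q r e (Mid-positive z<d (mirror-Mid z<d m))
                         (Mid-positive w<d (subst (Mid w z) (mirror-trunk e) m))
    where
    at-pair : ∀ q r → q + r ≡ d + d → 0 < q → 0 < r → map mirror (adjacent (trunk q)) ↭ adjacent (mirror (trunk q))
    at-pair (suc q) (suc r) e _ _ = subst₂ (λ ls l → ls ↭ adjacent l)
      (cong₂ (λ l l′ → l ∷ l′ ∷ [])
        (sym (mirror-trunk {q} {2 + r} (trans (+-suc q (suc r)) e)))
        (sym (mirror-trunk {2 + q} {r} (trans (cong suc (sym (+-suc q r))) e))))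
      (sym (mirror-trunk e)) (swap _ _ ↭-refl)

  record Scouted (w z p t : ℕ) : Set where
    constructor scouted
    field
      lab : Loc → ℕ
      lab-injective : Injective lab
      {ls} : List Loc
      run : Run A (tree lab) (trunk d) (trunk p ∷ ls)
      within : All (Mid w z) (trunk p ∷ ls)
      moves : length ls ≡ t
      effort : 2 * (w + z) ≤ t + ∣ p - d ∣

  reach-junction : ∀ {w z t} → Scouted w z 0 t → w ≡ d → Explored 0 0 z (trunk 0) t
  reach-junction {z = z} {t} (scouted lab inj run within moves effort) refl =
    explored lab inj run (All.map Mid⇒Within within) moves
      (subst (λ n → 2 * n ≤ t + d) (sym (trans (+-identityʳ _) (+-identityʳ (d + z)))) effort)

  -- The searcher has just reached depth `d` on the side away from the junction. No observation made
  -- at `trunk (d + d)` has been used yet, so the reflection may still turn this node into the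
  -- junction.
  mirrorScouted : ∀ {w z t} lab → Injective lab → ∀ {ls} → w < d → z < d →
    Run A (tree lab) (trunk d) (trunk (d + d) ∷ ls) → All (Mid w z) ls → length ls ≡ t →
    2 * (w + d) ≤ t + d → Scouted d w 0 t
  mirrorScouted {w} {z} {t} lab inj {vs} w<d z<d run within moves effort
    with Lift.lift {G = tree lab} {H = tree (lab ∘ mirror)} mirror (λ _ → refl) (Mid w z)
           (mirror-local w<d z<d) {s = trunk d} within
           (subst (λ l → Run A (tree lab) l (trunk (d + d) ∷ vs)) (sym (mirror-trunk refl)) run)
  ... | l , ls , l↦ , refl , run′
    -- As `mirror` is an involution, the node lying over `trunk (d + d)` is `trunk 0`.
    with refl ← trans (sym (mirror-involutive l)) (trans (cong mirror l↦) (mirror-trunk {r = 0} (+-identityʳ (d + d)))) =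
    scouted (lab ∘ mirror) (involutive⇒injective mirror mirror-involutive ∘ inj) run′
      ((≤-refl , z≤n) ∷ All.map (λ {l} → Mid-mono (<⇒≤ z<d) ≤-refl {l} ∘ mirror-Mid z<d {l}) (Allₚ.map⁻ within))
      (trans (sym (length-map mirror ls)) moves)
      (subst (λ n → 2 * n ≤ t + d) (+-comm w d) effort)

  -- Neither side has been followed to depth `d` so far. When one is, play passes to `search`,
  -- directly if it is the junction side and after a reflection otherwise.
  scout : ∀ f {w z p t} → Scouted w z p t → w < d → z < d → patience ≤ t + f → Outcome
  scout zero {t = t} (scouted lab inj run within moves _) w<d z<d p≤ =
    outcome lab inj run (All.map Mid⇒Within within) (<⇒≤ z<d) z≤n
      (late (≤-trans p≤ (≤-reflexive (trans (+-identityʳ t) (sym moves)))))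
  -- Being at the junction would require `w` to have reached `d`.
  scout (suc f) {p = zero} (scouted _ _ _ (m ∷ _) _ _) w<d _ _ = contradiction (Mid-positive w<d m) λ ()
  scout (suc f) {w} {z} {suc p} {t} (scouted lab inj {ls} run within@(m@(lo , hi) ∷ _) refl effort) w<d z<d p≤
    with next-move lab (trunk (suc p)) ls
  ... | inj₁ s = outcome lab inj run (All.map Mid⇒Within within) (<⇒≤ z<d) z≤n (stuck s)
  ... | inj₂ (_ , here refl , a) = left (≤-<-connex d (p + w))
    where
    p≤′ : patience ≤ suc t + f
    p≤′ = ≤-trans p≤ (≤-reflexive (+-suc t f))

    run′ = move (trunk p) run a (here refl)

    fresh : Scouted (suc w) z p (suc t) → d ≡ suc (p + w) → Outcome
    fresh S d≡ with m≤n⇒m<n∨m≡n w<d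
    ... | inj₁ w<′ = scout f S w<′ z<d p≤′
    ... | inj₂ w≡ with refl ← +-cancelʳ-≡ (suc w) p 0 (trans (+-suc p w) (trans (sym d≡) (sym w≡))) =
      search f (reach-junction S w≡) z<d z<d p≤′

    left : d ≤ p + w ⊎ p + w < d → Outcome
    left (inj₁ lo′) = scout f (scouted lab inj run′ ((lo′ , <⇒≤ hi) ∷ within) refl
      (stay-step {w + z} effort (∣suc-∣≤ p d))) w<d z<d p≤′
    left (inj₂ p+w<d) = fresh (scouted lab inj run′
      ((≤-reflexive (trans d≡ (sym (+-suc p w))) , <⇒≤ hi) ∷ All.map (λ {l} → Mid-mono (n≤1+n w) ≤-refl {l}) within) refl
      (double-step {w + z} effort refl (subst (λ n → ∣ p - n ∣ ≡ suc ∣ suc p - n ∣) (sym d≡) gap))) d≡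
      where
      d≡ : d ≡ suc (p + w)
      d≡ = ≤-antisym lo p+w<d
      gap : ∣ p - suc (p + w) ∣ ≡ suc ∣ p - p + w ∣
      gap = trans (cong (λ n → ∣ p - n ∣) (sym (+-suc p w))) (trans (∣m-m+n∣≡n p (suc w)) (cong suc (sym (∣m-m+n∣≡n p w))))
  ... | inj₂ (_ , there (here refl) , a) = right (m≤n⇒m<n∨m≡n hi)
    where
    p≤′ : patience ≤ suc t + f
    p≤′ = ≤-trans p≤ (≤-reflexive (+-suc t f))

    run′ = move (trunk (2 + p)) run a (there (here refl))

    lo′ : d ≤ suc (suc p) + w
    lo′ = m≤n⇒m≤1+n lo

    right : suc p < d + z ⊎ suc p ≡ d + z → Outcome
    right (inj₁ hi′) = scout f (scouted lab inj run′ ((lo′ , hi′) ∷ within) refl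
      (stay-step {w + z} effort (∣-∣≤∣suc-∣ (suc p) d))) w<d z<d p≤′
    right (inj₂ p≡) with m≤n⇒m<n∨m≡n z<d
    ... | inj₁ z<′ = scout f (scouted lab inj run′
            ((lo′ , ≤-reflexive tip) ∷ All.map (λ {l} → Mid-mono ≤-refl (n≤1+n z) {l}) within) refl
            (subst (λ n → 2 * (w + suc z) ≤ suc t + n) (sym gap) effort′)) w<d z<′ p≤′
      where
      tip : 2 + p ≡ d + suc z
      tip = trans (cong suc p≡) (sym (+-suc d z))
      gap : ∣ 2 + p - d ∣ ≡ suc z
      gap = trans (cong (λ n → ∣ n - d ∣) tip) (∣m+n-m∣≡n d (suc z))
      effort′ : 2 * (w + suc z) ≤ suc t + suc z
      effort′ = double-step {w + z} effort (+-suc w z) (cong suc (sym (trans (cong (λ n → ∣ n - d ∣) p≡) (∣m+n-m∣≡n d z))))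
    -- The far side wins: after the reflection the junction lies here and the former `w` is the
    -- extent of the ray.
    ... | inj₂ z≡ = search f (reach-junction
            (mirrorScouted lab inj w<d z<d (subst (λ q → Run A (tree lab) (trunk d) (trunk q ∷ trunk (suc p) ∷ ls)) tip run′) within refl effort′) refl)
            w<d w<d p≤′
      where
      tip : 2 + p ≡ d + d
      tip = trans (cong suc p≡) (trans (sym (+-suc d z)) (cong (d +_) z≡))
      effort′ : 2 * (w + d) ≤ suc t + d
      effort′ = double-step {w + z} effort (trans (cong (w +_) (sym z≡)) (+-suc w z))
        (trans (sym z≡) (cong suc (sym (trans (cong (λ n → ∣ n - d ∣) p≡) (∣m+n-m∣≡n d z)))))

  play : ∀ lab → Injective lab → 0 < d → Outcome
  play lab inj 0<d = scout patience
    (scouted lab inj start ((m≤m+n d 0 , m≤m+n d 0) ∷ []) refl z≤n) 0<d 0<d ≤-refl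

-- An injective labelling to start from.

-- Trunk, arm₁ and arm₂ occupy the residues 0, 1 and 2 modulo 3.
encode : Loc → ℕ
encode (trunk zero)    = 0
encode (trunk (suc p)) = 3 + encode (trunk p)
encode (arm₁ zero)     = 1
encode (arm₁ (suc k))  = 3 + encode (arm₁ k)
encode (arm₂ zero)     = 2
encode (arm₂ (suc k))  = 3 + encode (arm₂ k)

decode : ℕ → Loc
decode 0 = trunk 0
decode 1 = arm₁ 0
decode 2 = arm₂ 0
decode (suc (suc (suc n))) with decode n
... | trunk p = trunk (suc p)
... | arm₁ k  = arm₁ (suc k)
... | arm₂ k  = arm₂ (suc k)

decode-encode : ∀ l → decode (encode l) ≡ l
decode-encode (trunk zero) = refl
decode-encode (trunk (suc p)) rewrite decode-encode (trunk p) = refl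
decode-encode (arm₁ zero) = refl
decode-encode (arm₁ (suc k)) rewrite decode-encode (arm₁ k) = refl
decode-encode (arm₂ zero) = refl
decode-encode (arm₂ (suc k)) rewrite decode-encode (arm₂ k) = refl

encode-injective : Injective encode
encode-injective {l} {l′} e = trans (sym (decode-encode l)) (trans (cong decode e) (decode-encode l′))

-- The cost of a complete tour on the chosen tadpole.

leafDistance-cycle : ∀ {i j n m} → n < i → m ≤ n → n + m ≤ i → m + j ≤ leafDistance i j n
leafDistance-cycle {i} {j} {n} {m} n<i m≤n n+m≤i rewrite m≤n⇒m∸n≡0 n<i =
  +-monoˡ-≤ j (⊓-glb m≤n (m+n≤o⇒m≤o∸n m (subst (_≤ i) (+-comm n m) n+m≤i)))

leafDistance-leaf : ∀ i y → leafDistance i (suc y) (i + y) ≡ 0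
leafDistance-leaf i y = cong₂ _+_
  (trans (cong ((i + y) ⊓_) (m≤n⇒m∸n≡0 (m≤m+n i y))) (⊓-zeroʳ (i + y)))
  (trans (cong (suc y ∸_) (trans (cong (_∸ i) (sym (+-suc i y))) (m+n∸m≡n i (suc y)))) (n∸n≡0 y))

module Endgame (A : Algorithm) (d : ℕ) (O : Adversary.Outcome A d) where
  open Adversary A d
  open Outcome O

  -- Makes the cycle length `2d + 3` whatever `x` is. In the trapped case `d ∸ x` is `z`, so trunk
  -- and arm₁ each extend just one node beyond the explored part.
  c : ℕ
  c = suc (d + (d ∸ x))

  x≤d : x ≤ d
  x≤d = m+n≤o⇒m≤o x x+z≤d

  open World c x y (s≤s z≤n)
  open Labelled lab lab-injective public using (world)
  open Labelled lab lab-injective hiding (world)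

  I≡ : I ≡ 3 + (d + d)
  I≡ = trans (lemma d (d ∸ x) x) (cong (λ n → 3 + (d + n)) (m∸n+n≡m x≤d))
    where
    lemma : ∀ d e x → suc (suc (d + e)) + suc x ≡ 3 + (d + (e + x))
    lemma = solve-∀

  within-world : All (Within c x y) (l ∷ ls)
  within-world = All.map (λ {l} → Within-mono (s≤s (+-monoʳ-≤ d z≤d∸x)) ≤-refl ≤-refl {l}) within
    where
    z≤d∸x : z ≤ d ∸ x
    z≤d∸x = m+n≤o⇒m≤o∸n z (subst (_≤ d) (+-comm x z) x+z≤d)

  opt : ℕ
  opt = I + 2 * suc y

  s : Vertex world
  s = vertex world d

  d≤c : d ≤ c
  d≤c = m≤n⇒m≤1+n (m≤m+n d (d ∸ x))

  d<I : d < I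
  d<I = ≤-<-trans d≤c c<I

  place-s : placeᶠ s ≡ trunk d
  place-s = At-vertex (≤-trans d<I (m≤m+n I (suc y))) (at-trunk d≤c)

  leaf : Vertex world
  leaf = vertex world (I + y)

  leaf<size : I + y < I + suc y
  leaf<size = +-monoʳ-< I (n<1+n y)

  place-leaf : placeᶠ leaf ≡ arm₂ y
  place-leaf = At-vertex leaf<size (at-arm₂ ≤-refl refl)

  φ : Vertex world → ℕ
  φ v = leafDistance I (suc y) (toℕ v)

  φ-lipschitz : ∀ {u v} → Adj world u v ≡ true → φ u ≤ suc (φ v) × φ v ≤ suc (φ u)
  φ-lipschitz {u} {v} e with Adj⇒Edge world {u} {v} e
  ... | inj₁ e′ = leafDistance-lipschitz (0<i world) e′
  ... | inj₂ e′ = Product.swap (leafDistance-lipschitz (0<i world) e′)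

  φ-leaf : φ leaf ≡ 0
  φ-leaf = trans (cong (leafDistance I (suc y)) (toℕ-vertex world leaf<size)) (leafDistance-leaf I y)

  -- On a cycle of length `2d + 3` the start at index `d` is at least `d` from the junction either
  -- way.
  φ-s : d + suc y ≤ φ s
  φ-s rewrite toℕ-vertex world (≤-trans d<I (m≤m+n I (suc y))) =
    leafDistance-cycle d<I ≤-refl (subst (d + d ≤_) (sym I≡) (m≤n+m (d + d) 3))

  -- The tip of arm₁ is `x` from the junction along the arm and more than `d` the other way; the tip
  -- of the ray is `d + z` from it along the trunk and `x + 3` across the joining edge.
  φ-trap : x + z ≡ d → ∀ v → placeᶠ v ≡ l →
           (∃ λ k → x ≡ suc k × l ≡ arm₁ k) ⊎ l ≡ trunk (d + z) → x + suc y ≤ φ v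
  φ-trap x+z≡d v v↦l (inj₁ (k , x≡ , l≡)) with subst (At (toℕ v)) (trans v↦l l≡) (place-At (toℕ<n v))
  ... | at-arm₁ k≤x e = leafDistance-cycle (at-arm₁-< e)
          (≤-trans x≤d (≤-trans d≤c (<⇒≤ (at-arm₁-> k≤x e))))
          (≤-reflexive (trans (cong (toℕ v +_) x≡) (trans (+-suc (toℕ v) k) e)))
  φ-trap x+z≡d v v↦l (inj₂ l≡) = subst (λ n → x + suc y ≤ leafDistance I (suc y) n) (sym v≡)
      (leafDistance-cycle (≤-<-trans v≤c c<I) (≤-trans x≤d (m≤m+n d z)) v+x≤I)
    where
    v-at : At (toℕ v) (trunk (d + z))
    v-at = subst (At (toℕ v)) (trans v↦l l≡) (place-At (toℕ<n v))
    trunk-index : ∀ {n p} → At n (trunk p) → n ≡ p × p ≤ c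
    trunk-index (at-trunk p≤c) = refl , p≤c
    v≡ : toℕ v ≡ d + z
    v≡ = proj₁ (trunk-index v-at)
    v≤c : d + z ≤ c
    v≤c = proj₂ (trunk-index v-at)
    v+x≤I : d + z + x ≤ I
    v+x≤I = begin
      d + z + x     ≡⟨ +-assoc d z x ⟩
      d + (z + x)   ≡⟨ cong (d +_) (trans (+-comm z x) x+z≡d) ⟩
      d + d         ≤⟨ m≤n+m (d + d) 3 ⟩
      3 + (d + d)   ≡⟨ I≡ ⟨
      I             ∎
      where open ≤-Reasoning

  module Finish {xs : List (Vertex world)} (reach : Reach A world s (s ∷ xs)) (covers : ∀ v → v ∈ s ∷ xs)
                {p : Vertex world} {ps us : List (Vertex world)} (p↦l : placeᶠ p ≡ l) (ps↦ls : map placeᶠ ps ≡ ls)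
                (split : s ∷ xs ≡ us ++ p ∷ ps) where

    within-prefix : All (Within c x y) (map placeᶠ (p ∷ ps))
    within-prefix = subst (All (Within c x y)) (sym (cong₂ _∷_ p↦l ps↦ls)) within-world

    total : length xs ≡ length us + length ls
    total = suc-injective (begin
      suc (length xs)                  ≡⟨ cong length split ⟩
      length (us ++ p ∷ ps)            ≡⟨ length-++ us ⟩
      length us + suc (length ps)      ≡⟨ +-suc (length us) (length ps) ⟩
      suc (length us + length ps)      ≡⟨ cong (λ n → suc (length us + n)) (trans (sym (length-map placeᶠ ps)) (cong length ps↦ls)) ⟩
      suc (length us + length ls)      ∎)
      where open ≡-Reasoning

    -- The leaf is one node beyond the explored part of arm₂, so it is visited only after the prefix
    -- shared with the tree.
    leaf∈us : leaf ∈ us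
    leaf∈us = [ id , (λ leaf∈ → contradiction (unvisited leaf∈) (n≮n y)) ]′
                (∈-++⁻ us (subst (leaf ∈_) split (covers leaf)))
      where
      unvisited : leaf ∈ p ∷ ps → y < y
      unvisited leaf∈ = subst (Within c x y) place-leaf (All.lookup (Allₚ.map⁻ within-prefix) leaf∈)

    detour : φ p + φ s ≤ length us
    detour = go us split leaf∈us
      where
      go : ∀ us → s ∷ xs ≡ us ++ p ∷ ps → leaf ∈ us → φ p + φ s ≤ length us
      go (q ∷ us′) e leaf∈ with refl ← ∷-injectiveˡ e =
        detour-bound φ (λ {u} {v} → φ-lipschitz {u} {v}) us′ φ-leaf leaf∈ (subst (Reach A world s) e reach)

    -- The complete tour must go on to the leaf, and its next move from `p` leads to a neighbour
    -- that the tree has as well.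
    not-stuck : ¬ Stuck lab l ls
    not-stuck st = go us split leaf∈us
      where
      at-last : ∀ vs v → s ∷ xs ≡ (vs ∷ʳ v) ++ p ∷ ps → ⊥
      at-last vs v e = st
        (subst (λ l → placeᶠ v ∈ adjacent l) p↦l (Linked⇒∈ (Adj⇒Linked {p} {v} (All.head within-prefix) (proj₂ next))))
        (trans (cong A (trans (cong (obsHistory (tree lab)) (sym (cong₂ _∷_ p↦l ps↦ls)))
                              (sym (LiftWorld.history-g {A} (p ∷ ps) within-prefix))))
          (trans (proj₁ next) (cong just (sym (label-place v)))))
        where
        next : A (history world (p ∷ ps)) ≡ just (idOf world v) × Adj world p v ≡ true
        next = Reach-next vs (subst (Reach A world s) (trans e (∷ʳ-++ vs v (p ∷ ps))) reach)
      go : ∀ us → s ∷ xs ≡ us ++ p ∷ ps → leaf ∈ us → ⊥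
      go us e leaf∈ with initLast us
      go _ e () | []
      ... | vs ∷ʳ′ v = at-last vs v e

    judge : Verdict lab x y z l ls → 2 * opt ≤ length xs + 8
    judge (stuck st) = ⊥-elim (not-stuck st)
    judge (late t≥) = begin
      2 * opt                            ≡⟨ cong (λ n → 2 * (n + 2 * suc y)) I≡ ⟩
      2 * (3 + (d + d) + 2 * suc y)      ≤⟨ *-monoʳ-≤ 2 (+-monoʳ-≤ (3 + (d + d)) (*-monoʳ-≤ 2 (s≤s y≤d))) ⟩
      2 * (3 + (d + d) + 2 * suc d)      ≡⟨ lemma d ⟩
      patience                           ≤⟨ t≥ ⟩
      length ls                          ≤⟨ m≤n+m (length ls) (length us) ⟩
      length us + length ls              ≡⟨ total ⟨
      length xs                          ≤⟨ m≤m+n (length xs) 8 ⟩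
      length xs + 8                      ∎
      where
      open ≤-Reasoning
      lemma : ∀ d → 2 * (3 + (d + d) + 2 * suc d) ≡ 8 * d + 10
      lemma = solve-∀
    -- The prefix costs at least `3d + 2y - x` and the rest, by way of the leaf, at least
    -- `(x + y + 1) + (d + y + 1)`, together `4d + 4y + 2`; twice `opt` is `4d + 4y + 10`, whence
    -- the 8.
    judge (trapped x+z≡d t≥ at) = linear x
        (+-monoʳ-≤ 8 (+-mono-≤ (≤-trans (+-mono-≤ (φ-trap x+z≡d p p↦l at) φ-s) detour) t≥))
        (trans (lhs d x y) (cong (λ n → 2 * (n + 2 * suc y) + x) (sym I≡)))
        (trans (rhs (length us) (length ls) x) (cong (λ n → n + 8 + x) (sym total)))
      where
      lhs : ∀ d x y → 8 + (x + suc y + (d + suc y) + (3 * d + 2 * y)) ≡ 2 * (3 + (d + d) + 2 * suc y) + x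
      lhs = solve-∀
      rhs : ∀ u t x → 8 + (u + (t + x)) ≡ u + t + 8 + x
      rhs = solve-∀

  -- The adversary's run on the tree lifts to the tadpole, where by determinism it is a prefix of
  -- the complete tour.
  cost-bound : ∀ {k} → Explores A world s k → 2 * opt ≤ k + 8
  cost-bound (xs , reach , refl , stop , covers) = finish
      (LiftWorld.lift {A} {s = s} (All.tail within-world)
        (subst (λ v → Run A (tree lab) v (l ∷ ls)) (sym place-s) run))
    where
    finish : (∃ λ p → ∃ λ ps → placeᶠ p ≡ l × map placeᶠ ps ≡ ls × Run A (network world) s (p ∷ ps)) →
             2 * opt ≤ length xs + 8
    finish (p , ps , p↦l , ps↦ls , prefix) = Finish.judge reach covers p↦l ps↦ls
      (proj₂ (stopped-extends reach stop (Run⇒Reach world prefix))) verdict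

  opt-bound : ∀ {m} → IsOptCost world s m → m ≤ opt
  opt-bound (_ , minimal) = minimal opt (coverWalk world d (2 + d) (trans (lemma d) (sym I≡)))
    where
    lemma : ∀ d → suc (d + (2 + d)) ≡ 3 + (d + d)
    lemma = solve-∀

  2d<opt : 2 * d < opt
  2d<opt = ≤-trans (s≤s (≤-trans (≤-reflexive (cong (d +_) (+-identityʳ d))) (m≤n+m (d + d) 2)))
             (≤-trans (≤-reflexive (sym I≡)) (m≤m+n I (2 * suc y)))

-- Here `ε` is `p / q` and the inequality is multiplied by `q`. Rational values suffice, as a
-- smaller `ε` gives a stronger bound.
theorem1 : (p q : ℕ) → 0 < p → p < q → (A : Algorithm) →
    Σ Tadpole λ T → Σ (Vertex T) λ s →
    ∀ k m → Explores A T s k → IsOptCost T s m → (2 * q ∸ p) * m < q * k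
theorem1 p q 0<p p<q A = world , s , bound
  where
  -- Multiplied by `q`, the additive loss of 8 becomes `8 * q`, which is `2 * d` and so less than
  -- `opt`, hence less than the margin `p * opt`.
  d = 4 * q
  open Endgame A d (Adversary.play A d encode encode-injective (≤-trans (≤-trans 0<p (<⇒≤ p<q)) (m≤n*m q 4)))

  bound : ∀ k m → Explores A world s k → IsOptCost world s m → (2 * q ∸ p) * m < q * k
  bound k m explores optimal = ≤-<-trans (*-monoʳ-≤ (2 * q ∸ p) (opt-bound optimal))
    (+-cancelʳ-< (p * opt) _ _ (begin-strict
      (2 * q ∸ p) * opt + p * opt  ≡⟨ *-distribʳ-+ opt (2 * q ∸ p) p ⟨
      (2 * q ∸ p + p) * opt        ≡⟨ cong (_* opt) (m∸n+n≡m (≤-trans (<⇒≤ p<q) (m≤n*m q 2))) ⟩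
      2 * q * opt                  ≡⟨ lhs q opt ⟩
      q * (2 * opt)                ≤⟨ *-monoʳ-≤ q (cost-bound explores) ⟩
      q * (k + 8)                  ≡⟨ rhs q k ⟩
      q * k + 2 * d                <⟨ +-monoʳ-< (q * k) 2d<opt ⟩
      q * k + opt                  ≤⟨ +-monoʳ-≤ (q * k) (m≤n*m opt p ⦃ >-nonZero 0<p ⦄) ⟩
      q * k + p * opt              ∎))
    where
    open ≤-Reasoning
    lhs : ∀ q o → 2 * q * o ≡ q * (2 * o)
    lhs = solve-∀
    rhs : ∀ q k → q * (k + 8) ≡ q * k + 2 * (4 * q)
    rhs = solve-∀
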